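{- Let $f_1,\ldots,f_s\in\mathcal{L}$ be such that no nontrivial $\mathbb{Q}$-linear combination of $f_1'/f_1,\ldots,f_s'/f_s$ belongs to $\mathbb{Q}(x)$. Then $f_1,\ldots,f_s$ are algebraically independent over $\mathbb{Q}(x)$.
   Context: A sequence $a:\mathbb{N}\to\mathbb{Z}$ has the Lucas property if for every prime $p$, every $n\ge0$ and every $0\le j\le p-1$, $a(pn+j)\equiv a(n)a(j)\pmod p$. $\mathcal{L}$ denotes the set of power series $\sum_{n\ge0}a(n)x^n\in\mathbb{Z}[[x]]$ with $a(0)=1$, whose coefficient sequence has the Lucas property, and which satisfy a nonzero homogeneous linear differential equation with coefficients in $\mathbb{Q}(x)$. -}

module Defs where

open import Data.Nat as ℕ using (ℕ; zero; suc; _<_)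
open import Data.Nat.Primality using (Prime)
open import Data.Integer as ℤ using (ℤ; +_)
open import Data.Integer.Divisibility using (_∣_)
open import Data.Rational as ℚ using (ℚ; 0ℚ; 1ℚ)
open import Data.Fin using (Fin; zero; suc)
open import Data.List using (List; []; _∷_)
open import Data.List.Relation.Unary.Any using (Any)
open import Data.Product using (Σ; ∃; _×_)
open import Relation.Binary.PropositionalEquality using (_≡_; _≢_)
open import Relation.Nullary using (¬_)

Series : Set
Series = ℕ → ℚ

_≈ₛ_ : Series → Series → Set
f ≈ₛ g = ∀ n → f n ≡ g n

0ₛ : Series
0ₛ _ = 0ℚ

_+ₛ_ : Series → Series → Series
(f +ₛ g) n = f n ℚ.+ g n

_·ₛ_ : ℚ → Series → Series
(c ·ₛ f) n = c ℚ.* f n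

convAux : Series → Series → ℕ → ℕ → ℚ
convAux f g k zero    = f k ℚ.* g 0
convAux f g k (suc m) = f k ℚ.* g (suc m) ℚ.+ convAux f g (suc k) m

_*ₛ_ : Series → Series → Series
(f *ₛ g) n = convAux f g 0 n

ℕtoℚ : ℕ → ℚ
ℕtoℚ n = (+ n) ℚ./ 1

ℤtoℚ : ℤ → ℚ
ℤtoℚ z = z ℚ./ 1

deriv : Series → Series
deriv f n = ℕtoℚ (suc n) ℚ.* f (suc n)

derivN : ℕ → Series → Series
derivN zero    f = f
derivN (suc k) f = deriv (derivN k f)

-- multiplicative inverse of a series with constant term 1:
-- g(0) = 1, g(n+1) = - Σ_{i=0}^{n} f(i+1) g(n-i)
-- invList f n = [g(n), g(n-1), ..., g(0)]
invSum : Series → ℕ → List ℚ → ℚ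
invSum f i []       = 0ℚ
invSum f i (x ∷ xs) = f (suc i) ℚ.* x ℚ.+ invSum f (suc i) xs

invList : Series → ℕ → List ℚ
invList f zero    = 1ℚ ∷ []
invList f (suc n) = let gs = invList f n in ℚ.- invSum f 0 gs ∷ gs

headOr0 : List ℚ → ℚ
headOr0 []      = 0ℚ
headOr0 (x ∷ _) = x

inv₁ : Series → Series
inv₁ f n = headOr0 (invList f n)

-- logarithmic derivative f'/f (for f with f(0) = 1)
logDeriv : Series → Series
logDeriv f = deriv f *ₛ inv₁ f

-- Polynomials in ℚ[x], as coefficient lists (constant term first)

Polyℚ : Set
Polyℚ = List ℚ

NonzeroPoly : Polyℚ → Set
NonzeroPoly P = Any (λ q → q ≢ 0ℚ) P

polyToSeries : Polyℚ → Series
polyToSeries []       n       = 0ℚ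
polyToSeries (c ∷ cs) zero    = c
polyToSeries (c ∷ cs) (suc n) = polyToSeries cs n

IsRational : Series → Set
IsRational h = Σ Polyℚ λ A → Σ Polyℚ λ B →
  NonzeroPoly B × ((polyToSeries B *ₛ h) ≈ₛ polyToSeries A)

sumFinₛ : (s : ℕ) → (Fin s → Series) → Series
sumFinₛ zero    h = 0ₛ
sumFinₛ (suc s) h = h zero +ₛ sumFinₛ s (λ i → h (suc i))

-- D-finiteness: f satisfies a nonzero linear ODE  Σ_{i=0}^{r} P_i(x) f^{(i)} = 0
-- with P_i ∈ ℚ(x); after clearing denominators, P_i ∈ ℚ[x], not all zero.

DFinite : Series → Set
DFinite f = Σ ℕ λ r → Σ (Fin (suc r) → Polyℚ) λ P →
  (∃ λ i → NonzeroPoly (P i)) ×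
  (sumFinₛ (suc r) (λ i → polyToSeries (P i) *ₛ derivN (Data.Fin.toℕ i) f) ≈ₛ 0ₛ)

LucasProperty : (ℕ → ℤ) → Set
LucasProperty a = ∀ p → Prime p → ∀ n j → j < p →
  (+ p) ∣ (a (p ℕ.* n ℕ.+ j) ℤ.- a n ℤ.* a j)

toSeries : (ℕ → ℤ) → Series
toSeries a n = ℤtoℚ (a n)

Inℒ : (ℕ → ℤ) → Set
Inℒ a = (a 0 ≡ + 1) × LucasProperty a × DFinite (toSeries a)

-- Multivariate polynomials over ℚ[x] in s variables, recursively:
-- MPoly 0 = ℚ[x],  MPoly (s+1) = (MPoly s)[X]  (X is the first variable)

MPoly : ℕ → Set
MPoly zero    = Polyℚ
MPoly (suc s) = List (MPoly s)

NonzeroMPoly : (s : ℕ) → MPoly s → Set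
NonzeroMPoly zero    P  = NonzeroPoly P
NonzeroMPoly (suc s) Ps = Any (NonzeroMPoly s) Ps

evalMPoly : (s : ℕ) → MPoly s → (Fin s → Series) → Series
evalMPoly zero    P        f = polyToSeries P
evalMPoly (suc s) []       f = 0ₛ
evalMPoly (suc s) (P ∷ Ps) f =
  evalMPoly s P (λ i → f (suc i)) +ₛ (f zero *ₛ evalMPoly (suc s) Ps f)

-- algebraic independence over ℚ(x) (denominators cleared: coefficients in ℚ[x])
AlgIndependent : (s : ℕ) → (Fin s → Series) → Set
AlgIndependent s f = ∀ P → NonzeroMPoly s P → ¬ (evalMPoly s P f ≈ₛ 0ₛ)

{-# OPTIONS --safe #-}

-- Modulo a prime p, the Lucas property says f ≡ A · f(x^p) with A a polynomial of
-- degree < p, and the same holds for monomials in f₁, …, fₛ, with factors of degree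
-- O(p).  Take a relation Σ cₖ gₖ ≡ 0 between monomials gₖ ≡ Aₖ gₖ(x^p), i.e.
-- Σ dₖ gₖ(x^p) ≡ 0 with dₖ = cₖ Aₖ.  Taking the coefficients at x^(np+r) turns it
-- into relations of smaller degree between the gₖ, down to a degree bounded
-- independently of p.  As gₖ(x^p) has zero derivative, Σ dₖ′ gₖ(x^p) ≡ 0 as well, and
-- eliminating d₀ shows that a shortest relation has dₖ/d₀ of zero derivative.  Then
-- (cₖ gₖ)/(c₀ g₀) has zero derivative, so gₖ′/gₖ − g₀′/g₀ is modulo p a quotient of
-- polynomials of bounded degree.  If this happens for arbitrarily large p, linear
-- algebra makes gₖ′/gₖ − g₀′/g₀, an integral combination of the fᵢ′/fᵢ, rational.
module Submission where

open import Defs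
open import Algebra using (CommutativeRing; Op₂)
import Algebra.Solver.Ring.NaturalCoefficients.Default as SemiringSolver
open import Data.Empty using (⊥)
open import Data.Fin as Fin using (Fin; zero; suc)
open import Data.Integer as ℤ using (ℤ; +_)
open import Data.Integer.Divisibility.Signed
open import Data.Integer.Tactic.RingSolver using (solve-∀)
import Data.Integer.Properties as ℤ
open import Data.List as List using (List; []; _∷_)
open import Data.List.Membership.Propositional.Properties using (∈-lookup)
open import Data.List.Relation.Unary.All as All using (All; []; _∷_)
import Data.List.Relation.Unary.All.Properties as All
open import Data.List.Relation.Unary.AllPairs as AllPairs using (AllPairs; []; _∷_)
import Data.List.Relation.Unary.AllPairs.Properties as AllPairs
open import Data.List.Relation.Unary.Any as Any using (Any; here; there)
import Data.List.Relation.Unary.Any.Properties as Any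
open import Data.Nat as ℕ using (ℕ; zero; suc; _<_; _≤_; z≤n; s≤s; s≤s⁻¹; _!)
import Data.Nat.Divisibility as ℕ
open import Data.Nat.DivMod using (_/_; _%_; m≡m%n+[m/n]*n; m%n<n)
open import Data.Nat.Primality using (Prime; euclidsLemma; prime⇒nonZero; prime⇒nonTrivial)
open import Data.Nat.Primality.Factorisation using (factorise)
import Data.Nat.Properties as ℕ
open import Data.Product using (∃; _,_; _×_; proj₁; proj₂)
open import Data.Rational as ℚ using (ℚ; 0ℚ; 1ℚ; toℚᵘ; ↥_; ↧_)
import Data.Rational.Properties as ℚ
open import Data.Rational.Unnormalised as ℚᵘ using (mkℚᵘ; *≡*; _≃_)
import Data.Rational.Unnormalised.Properties as ℚᵘ
open import Data.Sum as Sum using (_⊎_; inj₁; inj₂)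
open import Data.Vec as Vec using (Vec; []; _∷_; head; lookup; map; replicate; zipWith)
open import Data.Vec.Relation.Unary.All as VecAll using ([]; _∷_)
open import Data.Vec.Relation.Unary.Any as VecAny using (here; there)
open import Function using (_∘_)
open import Level using (Level; 0ℓ; _⊔_)
open import Relation.Binary.PropositionalEquality as ≡ using (_≡_; _≢_)
open import Relation.Nullary using (¬_; Dec; yes; no; contradiction)
open import Relation.Nullary.Decidable as Dec using (decidable-stable)

-- Formal power series

-- The degree bound must not depend on p for the primes to say anything about ℚ. Denominators and
-- numerators of length at most `d` are then the same unknowns for every p, and "b·ψ has length d"
-- is a linear system for b with integer coefficients that do not involve p. Elimination over ℤ
-- meets finitely many pivots and stays valid modulo every prime larger than all of them.
--
-- The bound is a fixed point of L ↦ ⌈(L + Mp)/p⌉, the effect on lengths of multiplying by a factor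
-- of length Mp and keeping every p-th coefficient: for p ≥ M + 2 larger lengths decrease to M + 1.
-- Eliminating with derivatives brings back lengths of order Mp, so the shortest relation takes the
-- form of a lexicographic induction, on the number of monomials with coefficients of arbitrary
-- degree, and then on the degree.
--
-- Irrationality is a negative hypothesis, from which neither a pivot nor a threshold for p can be
-- computed. Thresholds therefore exist only under a double negation, which is enough because the
-- conclusion is a negation.

tail : ∀ {a} {A : Set a} → (ℕ → A) → ℕ → A
tail f n = f (suc n)

-- The operations depend on the raw operations of A only, so that power series
-- over ℤ and over ℤ/p (which is ℤ with a coarser equality) share them.
module SeriesOperations {a : Level} {A : Set a} (_+_ _*_ : Op₂ A) (0# 1# : A) (ν : ℕ → A) where

  mul : Op₂ (ℕ → A)
  mul f g zero    = f 0 * g 0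
  mul f g (suc n) = (f 0 * g (suc n)) + mul (tail f) g n

  one : ℕ → A
  one zero    = 1#
  one (suc n) = 0#

  ∂ : (ℕ → A) → ℕ → A
  ∂ f n = ν (suc n) * f (suc n)

  pow : (ℕ → A) → ℕ → ℕ → A
  pow f zero    = one
  pow f (suc e) = mul f (pow f e)

  monomial : ∀ {s} → (Fin s → ℕ → A) → Vec ℕ s → ℕ → A
  monomial f []      = one
  monomial f (e ∷ v) = mul (pow (f zero) e) (monomial (f ∘ suc) v)

  sum : ∀ {N} → (Fin N → ℕ → A) → ℕ → A
  sum {zero}  h n = 0#
  sum {suc N} h n = h zero n + sum (h ∘ suc) n

  -- stretch q r g is x^r · g(x^(q+1)).
  stretch : ℕ → ℕ → (ℕ → A) → ℕ → A
  stretch q zero    g zero    = g 0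
  stretch q zero    g (suc n) = stretch q q (tail g) n
  stretch q (suc r) g zero    = 0#
  stretch q (suc r) g (suc n) = stretch q r g n

module PowerSeries {c ℓ : Level} (R : CommutativeRing c ℓ)
  (ν : ℕ → CommutativeRing.Carrier R)
  (ν-zero : CommutativeRing._≈_ R (ν 0) (CommutativeRing.0# R))
  (ν-suc : ∀ n → CommutativeRing._≈_ R (ν (suc n))
                   (CommutativeRing._+_ R (CommutativeRing.1# R) (ν n)))
  where

  open CommutativeRing R hiding (zero)
  open SemiringSolver commutativeSemiring using (solve; _:=_; _:+_; _:*_; con)
  open import Relation.Binary.Reasoning.Setoid setoid
  open SeriesOperations _+_ _*_ 0# 1# ν public

  mul-cong : ∀ {f f′ g g′ : ℕ → Carrier} → (∀ n → f n ≈ f′ n) → (∀ n → g n ≈ g′ n) →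
    ∀ n → mul f g n ≈ mul f′ g′ n
  mul-cong p q zero    = *-cong (p 0) (q 0)
  mul-cong p q (suc n) = +-cong (*-cong (p 0) (q (suc n))) (mul-cong (p ∘ suc) q n)

  mul-zeroˡ : ∀ (g : ℕ → Carrier) n → mul (λ _ → 0#) g n ≈ 0#
  mul-zeroˡ g zero    = zeroˡ (g 0)
  mul-zeroˡ g (suc n) = trans (+-cong (zeroˡ _) (mul-zeroˡ g n)) (+-identityˡ 0#)

  mul-distribʳ : ∀ (h f g : ℕ → Carrier) n →
    mul (λ i → f i + g i) h n ≈ mul f h n + mul g h n
  mul-distribʳ h f g zero    = distribʳ _ _ _
  mul-distribʳ h f g (suc n) = begin
    (f 0 + g 0) * h (suc n) + mul (λ i → f (suc i) + g (suc i)) h n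
      ≈⟨ +-congˡ (mul-distribʳ h (tail f) (tail g) n) ⟩
    (f 0 + g 0) * h (suc n) + (mul (tail f) h n + mul (tail g) h n)
      ≈⟨ solve 5 (λ a b x u v → (a :+ b) :* x :+ (u :+ v) := (a :* x :+ u) :+ (b :* x :+ v))
           refl _ _ _ _ _ ⟩
    mul f h (suc n) + mul g h (suc n) ∎

  mul-scaleˡ : ∀ a (f g : ℕ → Carrier) n → mul (λ i → a * f i) g n ≈ a * mul f g n
  mul-scaleˡ a f g zero    = *-assoc _ _ _
  mul-scaleˡ a f g (suc n) = begin
    (a * f 0) * g (suc n) + mul (λ i → a * f (suc i)) g n
      ≈⟨ +-cong (*-assoc _ _ _) (mul-scaleˡ a (tail f) g n) ⟩
    a * (f 0 * g (suc n)) + a * mul (tail f) g n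
      ≈⟨ distribˡ _ _ _ ⟨
    a * mul f g (suc n) ∎

  mul-sucʳ : ∀ (f g : ℕ → Carrier) n → mul f g (suc n) ≈ mul f (tail g) n + f (suc n) * g 0
  mul-sucʳ f g zero    = refl
  mul-sucʳ f g (suc n) = trans (+-congˡ (mul-sucʳ (tail f) g n)) (sym (+-assoc _ _ _))

  mul-comm : ∀ (f g : ℕ → Carrier) n → mul f g n ≈ mul g f n
  mul-comm f g zero    = *-comm _ _
  mul-comm f g (suc n) = begin
    f 0 * g (suc n) + mul (tail f) g n  ≈⟨ +-cong (*-comm _ _) (mul-comm (tail f) g n) ⟩
    g (suc n) * f 0 + mul g (tail f) n  ≈⟨ +-comm _ _ ⟩
    mul g (tail f) n + g (suc n) * f 0  ≈⟨ mul-sucʳ g f n ⟨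
    mul g f (suc n) ∎

  mul-assoc : ∀ (f g h : ℕ → Carrier) n → mul (mul f g) h n ≈ mul f (mul g h) n
  mul-assoc f g h zero    = *-assoc _ _ _
  mul-assoc f g h (suc n) = begin
    (f 0 * g 0) * h (suc n) + mul (λ i → f 0 * g (suc i) + mul (tail f) g i) h n
      ≈⟨ +-congˡ (mul-distribʳ h (λ i → f 0 * g (suc i)) (mul (tail f) g) n) ⟩
    (f 0 * g 0) * h (suc n) + (mul (λ i → f 0 * g (suc i)) h n + mul (mul (tail f) g) h n)
      ≈⟨ +-congˡ (+-cong (mul-scaleˡ (f 0) (tail g) h n) (mul-assoc (tail f) g h n)) ⟩
    (f 0 * g 0) * h (suc n) + (f 0 * mul (tail g) h n + mul (tail f) (mul g h) n)
      ≈⟨ solve 5 (λ a b x u v → (a :* b) :* x :+ (a :* u :+ v) := a :* (b :* x :+ u) :+ v)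
           refl _ _ _ _ _ ⟩
    f 0 * (g 0 * h (suc n) + mul (tail g) h n) + mul (tail f) (mul g h) n ∎

  mul-identityˡ : ∀ (f : ℕ → Carrier) n → mul one f n ≈ f n
  mul-identityˡ f zero    = *-identityˡ _
  mul-identityˡ f (suc n) =
    trans (+-cong (*-identityˡ _) (mul-zeroˡ f n)) (+-identityʳ _)

  seriesRing : CommutativeRing c ℓ
  seriesRing = record
    { Carrier = ℕ → Carrier
    ; _≈_ = λ f g → ∀ n → f n ≈ g n
    ; _+_ = λ f g n → f n + g n
    ; _*_ = mul
    ; -_  = λ f n → - f n
    ; 0#  = λ _ → 0#
    ; 1#  = one
    ; isCommutativeRing = record
      { isRing = record
        { +-isAbelianGroup = record
          { isGroup = record
            { isMonoid = record
              { isSemigroup = record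
                { isMagma = record
                  { isEquivalence = record
                    { refl = λ _ → refl ; sym = λ p n → sym (p n) ; trans = λ p q n → trans (p n) (q n) }
                  ; ∙-cong = λ p q n → +-cong (p n) (q n) }
                ; assoc = λ f g h n → +-assoc _ _ _ }
              ; identity = (λ f n → +-identityˡ _) , (λ f n → +-identityʳ _) }
            ; inverse = (λ f n → -‿inverseˡ _) , (λ f n → -‿inverseʳ _)
            ; ⁻¹-cong = λ p n → -‿cong (p n) }
          ; comm = λ f g n → +-comm _ _ }
        ; *-cong = mul-cong
        ; *-assoc = mul-assoc
        ; *-identity = mul-identityˡ , λ f n → trans (mul-comm f one n) (mul-identityˡ f n)
        ; distrib = (λ h f g n → trans (mul-comm h _ n)
                       (trans (mul-distribʳ h f g n) (+-cong (mul-comm f h n) (mul-comm g h n))))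
                  , mul-distribʳ }
      ; *-comm = mul-comm } }

  module S where
    open CommutativeRing seriesRing public
    open SemiringSolver (CommutativeRing.commutativeSemiring seriesRing) public using (solve; _:=_; _:+_; _:*_)
    open import Relation.Binary.Reasoning.Setoid (CommutativeRing.setoid seriesRing) public

  -- This is the Leibniz rule for x·d/dx, which leaves indices in place and so passes through the
  -- recursion of `mul`. The rule for `∂` is its instance at `suc n`.
  ν-mul : ∀ (f g : ℕ → Carrier) n →
    ν n * mul f g n ≈ mul (λ i → ν i * f i) g n + mul f (λ i → ν i * g i) n
  ν-mul f g zero    = begin
    ν 0 * (f 0 * g 0)                      ≈⟨ *-congʳ ν-zero ⟩
    0# * (f 0 * g 0)                       ≈⟨ solve 2 (λ a b → con 0 :* (a :* b)
                                                := (con 0 :* a) :* b :+ a :* (con 0 :* b)) refl _ _ ⟩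
    (0# * f 0) * g 0 + f 0 * (0# * g 0)    ≈⟨ +-cong (*-congʳ (*-congʳ ν-zero)) (*-congˡ (*-congʳ ν-zero)) ⟨
    (ν 0 * f 0) * g 0 + f 0 * (ν 0 * g 0)  ∎
  ν-mul f g (suc n) = begin
    ν (suc n) * (f 0 * g (suc n) + mul (tail f) g n)
      ≈⟨ distribˡ _ _ _ ⟩
    ν (suc n) * (f 0 * g (suc n)) + ν (suc n) * mul (tail f) g n
      ≈⟨ +-congˡ (*-congʳ (ν-suc n)) ⟩
    ν (suc n) * (f 0 * g (suc n)) + (1# + ν n) * mul (tail f) g n
      ≈⟨ solve 5 (λ a b x u v → a :* (b :* x) :+ (con 1 :+ u) :* v
           := con 0 :* b :* x :+ (v :+ u :* v) :+ b :* (a :* x)) refl _ _ _ _ _ ⟩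
    0# * f 0 * g (suc n) + (mul (tail f) g n + ν n * mul (tail f) g n) + f 0 * (ν (suc n) * g (suc n))
      ≈⟨ +-congʳ (+-cong (*-congʳ (*-congʳ (sym ν-zero))) (+-congˡ (ν-mul (tail f) g n))) ⟩
    ν 0 * f 0 * g (suc n) + (mul (tail f) g n + (mul (λ i → ν i * f (suc i)) g n + mul (tail f) (λ i → ν i * g i) n))
      + f 0 * (ν (suc n) * g (suc n))
      ≈⟨ solve 5 (λ a b x u v → a :+ (b :+ (x :+ u)) :+ v := (a :+ (b :+ x)) :+ (v :+ u)) refl _ _ _ _ _ ⟩
    (ν 0 * f 0 * g (suc n) + (mul (tail f) g n + mul (λ i → ν i * f (suc i)) g n))
      + mul f (λ i → ν i * g i) (suc n)
      ≈⟨ +-congʳ (+-congˡ (mul-distribʳ g (tail f) (λ i → ν i * f (suc i)) n)) ⟨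
    (ν 0 * f 0 * g (suc n) + mul (λ i → f (suc i) + ν i * f (suc i)) g n)
      + mul f (λ i → ν i * g i) (suc n)
      ≈⟨ +-congʳ (+-congˡ (mul-cong (λ i → trans
           (solve 2 (λ a b → b :+ a :* b := (con 1 :+ a) :* b) refl _ _) (*-congʳ (sym (ν-suc i))))
           (λ _ → refl) n)) ⟩
    mul (λ i → ν i * f i) g (suc n) + mul f (λ i → ν i * g i) (suc n) ∎

  ∂-mul : ∀ (f g : ℕ → Carrier) n → ∂ (mul f g) n ≈ mul (∂ f) g n + mul f (∂ g) n
  ∂-mul f g n = begin
    ν (suc n) * mul f g (suc n)
      ≈⟨ ν-mul f g (suc n) ⟩
    (ν 0 * f 0 * g (suc n) + mul (∂ f) g n) + mul f (λ i → ν i * g i) (suc n)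
      ≈⟨ +-congˡ (mul-sucʳ f (λ i → ν i * g i) n) ⟩
    (ν 0 * f 0 * g (suc n) + mul (∂ f) g n) + (mul f (∂ g) n + f (suc n) * (ν 0 * g 0))
      ≈⟨ +-cong (+-congʳ (*-congʳ (*-congʳ ν-zero))) (+-congˡ (*-congˡ (*-congʳ ν-zero))) ⟩
    (0# * f 0 * g (suc n) + mul (∂ f) g n) + (mul f (∂ g) n + f (suc n) * (0# * g 0))
      ≈⟨ solve 6 (λ a b u v x y → (con 0 :* a :* b :+ u) :+ (v :+ x :* (con 0 :* y)) := u :+ v)
           refl _ _ _ _ _ _ ⟩
    mul (∂ f) g n + mul f (∂ g) n ∎

  ∂-cong : ∀ {f g} → f S.≈ g → ∂ f S.≈ ∂ g
  ∂-cong p n = *-congˡ (p (suc n))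

  ∂-+ : ∀ f g → ∂ (f S.+ g) S.≈ (∂ f S.+ ∂ g)
  ∂-+ f g n = distribˡ _ _ _

  ∂-0 : ∂ S.0# S.≈ S.0#
  ∂-0 n = zeroʳ _

  ∂-one : ∂ one S.≈ S.0#
  ∂-one n = zeroʳ _

  sum-cong : ∀ {N} {h k : Fin N → ℕ → Carrier} → (∀ i → h i S.≈ k i) → sum h S.≈ sum k
  sum-cong {zero}  p n = refl
  sum-cong {suc N} p n = +-cong (p zero n) (sum-cong (p ∘ suc) n)

  sum-0 : ∀ {N} (h : Fin N → ℕ → Carrier) → (∀ i → h i S.≈ S.0#) → sum h S.≈ S.0#
  sum-0 {zero}  h p n = refl
  sum-0 {suc N} h p n = trans (+-cong (p zero n) (sum-0 (h ∘ suc) (p ∘ suc) n)) (+-identityˡ _)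

  sum-+ : ∀ {N} (h k : Fin N → ℕ → Carrier) → sum (λ i → h i S.+ k i) S.≈ (sum h S.+ sum k)
  sum-+ {zero}  h k n = sym (+-identityˡ _)
  sum-+ {suc N} h k n = trans (+-congˡ (sum-+ (h ∘ suc) (k ∘ suc) n))
    (solve 4 (λ a b x y → (a :+ b) :+ (x :+ y) := (a :+ x) :+ (b :+ y)) refl _ _ _ _)

  *-distribˡ-sum : ∀ {N} f (h : Fin N → ℕ → Carrier) → (f S.* sum h) S.≈ sum (λ i → f S.* h i)
  *-distribˡ-sum {zero}  f h = S.zeroʳ f
  *-distribˡ-sum {suc N} f h = S.trans (S.distribˡ f _ _) (S.+-congˡ (*-distribˡ-sum f (h ∘ suc)))

  ∂-sum : ∀ {N} (h : Fin N → ℕ → Carrier) → ∂ (sum h) S.≈ sum (∂ ∘ h)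
  ∂-sum {zero}  h = ∂-0
  ∂-sum {suc N} h = S.trans (∂-+ (h zero) (sum (h ∘ suc))) (S.+-congˡ (∂-sum (h ∘ suc)))

  -- Cartier operators and the substitution of x^p

  module Cartier (q : ℕ) where

    p : ℕ
    p = suc q

    σ : (ℕ → Carrier) → ℕ → Carrier
    σ = stretch q 0

    Λ : ℕ → (ℕ → Carrier) → ℕ → Carrier
    Λ r f n = f (n ℕ.* p ℕ.+ r)

    mul-stretch-shift : ∀ r (g f : ℕ → Carrier) n →
      mul (stretch q r g) f (r ℕ.+ n) ≈ mul (stretch q 0 g) f n
    mul-stretch-shift zero    g f n = refl
    mul-stretch-shift (suc r) g f n =
      trans (+-cong (zeroˡ _) (mul-stretch-shift r g f n)) (+-identityˡ _)

    mul-stretch-low : ∀ r (g f : ℕ → Carrier) n → n < r → mul (stretch q r g) f n ≈ 0#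
    mul-stretch-low (suc r) g f zero    n<r = zeroˡ _
    mul-stretch-low (suc r) g f (suc n) n<r =
      trans (+-cong (zeroˡ _) (mul-stretch-low r g f n (s≤s⁻¹ n<r))) (+-identityˡ _)

    -- Multiplication by `σ g` moves coefficients of `f` by multiples of p, hence within residue
    -- classes. Each coefficient of `g` that the recursion peels off uses up one block of p indices.
    Λ-mul : ∀ r → r < p → ∀ (g f : ℕ → Carrier) → Λ r (mul (σ g) f) S.≈ mul g (Λ r f)
    Λ-mul zero    r<p g f zero    = refl
    Λ-mul (suc r) r<p g f zero    =
      trans (+-congˡ (mul-stretch-low q (tail g) f r (s≤s⁻¹ r<p))) (+-identityʳ _)
    Λ-mul r       r<p g f (suc n) = +-congˡ (begin
      mul (stretch q q (tail g)) f ((q ℕ.+ n ℕ.* p) ℕ.+ r)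
        ≡⟨ ≡.cong (mul (stretch q q (tail g)) f) (ℕ.+-assoc q (n ℕ.* p) r) ⟩
      mul (stretch q q (tail g)) f (q ℕ.+ (n ℕ.* p ℕ.+ r))
        ≈⟨ mul-stretch-shift q (tail g) f (n ℕ.* p ℕ.+ r) ⟩
      mul (σ (tail g)) f (n ℕ.* p ℕ.+ r)
        ≈⟨ Λ-mul r r<p (tail g) f n ⟩
      mul (tail g) (Λ r f) n ∎)

    Λ-ext : ∀ {f g} → (∀ r → r < p → Λ r f S.≈ Λ r g) → f S.≈ g
    Λ-ext {f} {g} eq n = begin
      f n                      ≡⟨ ≡.cong f decomposition ⟩
      f (n / p ℕ.* p ℕ.+ n % p)  ≈⟨ eq (n % p) (m%n<n n p) (n / p) ⟩
      g (n / p ℕ.* p ℕ.+ n % p)  ≡⟨ ≡.cong g decomposition ⟨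
      g n                      ∎
      where
      decomposition : n ≡ n / p ℕ.* p ℕ.+ n % p
      decomposition = ≡.trans (m≡m%n+[m/n]*n n p) (ℕ.+-comm (n % p) _)

    Λ-σ : ∀ r → r < p → ∀ g → Λ r (σ g) S.≈ mul g (Λ r one)
    Λ-σ r r<p g = S.trans (λ n → sym (S.*-identityʳ (σ g) (n ℕ.* p ℕ.+ r))) (Λ-mul r r<p g one)

    Λ-one : ∀ r n → Λ (suc r) one n ≡ 0#
    Λ-one r n rewrite ℕ.+-suc (n ℕ.* p) r = ≡.refl

    -- Comparing sections avoids rearranging a double sum: by `Λ-mul` both sides have the section
    -- `f`·`g`·`Λ r one`.
    σ-mul : ∀ f g → σ (mul f g) S.≈ mul (σ f) (σ g)
    σ-mul f g = Λ-ext λ r r<p → S.begin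
      Λ r (σ (mul f g))        S.≈⟨ Λ-σ r r<p (mul f g) ⟩
      mul (mul f g) (Λ r one)  S.≈⟨ S.*-assoc f g (Λ r one) ⟩
      mul f (mul g (Λ r one))  S.≈⟨ S.*-congˡ (Λ-σ r r<p g) ⟨
      mul f (Λ r (σ g))        S.≈⟨ Λ-mul r r<p f (σ g) ⟨
      Λ r (mul (σ f) (σ g))    S.∎

    σ-one : σ one S.≈ one
    σ-one = Λ-ext λ r r<p → S.trans (Λ-σ r r<p one) (S.*-identityˡ (Λ r one))

    -- For x·d/dx the residue classes separate: class 0 carries the weights ν(np) = 0, and in the
    -- other classes `σ g` has no coefficients.
    ∂-σ : (∀ n → ν (n ℕ.* p) ≈ 0#) → ∀ g → ∂ (σ g) S.≈ S.0#
    ∂-σ ν-p g n = Λ-ext {λ n → ν n * σ g n} {S.0#} vanish (suc n)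
      where
      vanish : ∀ r → r < p → ∀ n → ν (n ℕ.* p ℕ.+ r) * σ g (n ℕ.* p ℕ.+ r) ≈ 0#
      vanish zero    r<p n = trans (*-congʳ (trans (reflexive (≡.cong ν (ℕ.+-identityʳ _))) (ν-p n))) (zeroˡ _)
      vanish (suc r) r<p n = trans (*-congˡ (begin
        Λ (suc r) (σ g) n          ≈⟨ Λ-σ (suc r) r<p g n ⟩
        mul g (Λ (suc r) one) n    ≈⟨ S.*-congˡ {g} (λ i → reflexive (Λ-one r i)) n ⟩
        mul g S.0# n               ≈⟨ S.zeroʳ g n ⟩
        0#                         ∎)) (zeroʳ _)

  -- Degree bounds

  Length : ℕ → (ℕ → Carrier) → Set ℓ
  Length a f = ∀ n → a ≤ n → f n ≈ 0#

  Length-≤ : ∀ {a b f} → a ≤ b → Length a f → Length b f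
  Length-≤ a≤b len n b≤n = len n (ℕ.≤-trans a≤b b≤n)

  Length-+ : ∀ {a f g} → Length a f → Length a g → Length a (f S.+ g)
  Length-+ p q n a≤n = trans (+-cong (p n a≤n) (q n a≤n)) (+-identityˡ _)

  Length-∂ : ∀ {a f} → Length a f → Length a (∂ f)
  Length-∂ p n a≤n = trans (*-congˡ (p (suc n) (ℕ.m≤n⇒m≤1+n a≤n))) (zeroʳ _)

  Length-neg : ∀ {a f} → Length a f → Length a (S.- f)
  Length-neg {f = f} p n a≤n = begin
    - f n       ≈⟨ +-identityʳ _ ⟨
    - f n + 0#  ≈⟨ +-congˡ (p n a≤n) ⟨
    - f n + f n ≈⟨ -‿inverseˡ _ ⟩
    0#          ∎

  Length-mul : ∀ {a b f g} → Length a f → Length b g → Length (a ℕ.+ b) (mul f g)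
  Length-mul {zero}  {f = f} {g} p q n a≤n =
    trans (mul-cong (λ i → p i z≤n) (λ _ → refl) n) (mul-zeroˡ g n)
  Length-mul {suc a} p q (suc n) a≤n = trans
    (+-cong (trans (*-congˡ (q (suc n) (ℕ.m≤n⇒m≤1+n (ℕ.≤-trans (ℕ.m≤n+m _ a) (s≤s⁻¹ a≤n))))) (zeroʳ _))
            (Length-mul {a} (λ i a≤i → p (suc i) (s≤s a≤i)) q n (s≤s⁻¹ a≤n)))
    (+-identityˡ _)

  Length-one : Length 1 one
  Length-one (suc n) _ = refl

  -- Logarithmic derivatives, as factors φ in f′ = φ·f

  ∂-mul-log : ∀ {f g φ χ} → ∂ f S.≈ mul φ f → ∂ g S.≈ mul χ g →
    ∂ (mul f g) S.≈ mul (φ S.+ χ) (mul f g)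
  ∂-mul-log {f} {g} {φ} {χ} ∂f ∂g = S.begin
    ∂ (mul f g)                            S.≈⟨ ∂-mul f g ⟩
    mul (∂ f) g S.+ mul f (∂ g)            S.≈⟨ S.+-cong (S.*-congʳ {g} ∂f) (S.*-congˡ {f} ∂g) ⟩
    mul (mul φ f) g S.+ mul f (mul χ g)    S.≈⟨ S.solve 4 (λ f g φ χ → (φ S.:* f) S.:* g S.:+ f S.:* (χ S.:* g)
                                                S.:= (φ S.:+ χ) S.:* (f S.:* g)) S.refl f g φ χ ⟩
    mul (φ S.+ χ) (mul f g)                S.∎

  ∂-pow-log : ∀ {f φ} → ∂ f S.≈ mul φ f → ∀ e →
    ∂ (pow f e) S.≈ mul (λ n → ν e * φ n) (pow f e)
  ∂-pow-log {f} {φ} ∂f zero    = S.trans ∂-one (S.sym (S.trans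
    (S.*-congʳ {one} λ n → trans (*-congʳ ν-zero) (zeroˡ (φ n))) (S.zeroˡ one)))
  ∂-pow-log {f} {φ} ∂f (suc e) = S.trans (∂-mul-log ∂f (∂-pow-log ∂f e))
    (S.*-congʳ {pow f (suc e)} λ n → trans
      (solve 2 (λ x m → x :+ m :* x := (con 1 :+ m) :* x) refl (φ n) (ν e))
      (*-congʳ (sym (ν-suc e))))

  exponents·_ : ∀ {s} → Vec ℕ s → (Fin s → ℕ → Carrier) → ℕ → Carrier
  (exponents· v) φ = sum (λ i n → ν (lookup v i) * φ i n)

  ∂-monomial-log : ∀ {s} {f φ : Fin s → ℕ → Carrier} → (∀ i → ∂ (f i) S.≈ mul (φ i) (f i)) →
    ∀ v → ∂ (monomial f v) S.≈ mul ((exponents· v) φ) (monomial f v)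
  ∂-monomial-log ∂f []      = S.trans ∂-one (S.sym (S.zeroˡ one))
  ∂-monomial-log ∂f (e ∷ v) = ∂-mul-log (∂-pow-log (∂f zero) e) (∂-monomial-log (∂f ∘ suc) v)

  unit-cancelʳ : ∀ {g g⁻¹} x y → mul g g⁻¹ S.≈ one → mul x g S.≈ mul y g → x S.≈ y
  unit-cancelʳ {g} {g⁻¹} x y inv eq = S.begin
    x                    S.≈⟨ S.*-identityʳ x ⟨
    mul x one            S.≈⟨ S.*-congˡ {x} inv ⟨
    mul x (mul g g⁻¹)    S.≈⟨ S.*-assoc x g g⁻¹ ⟨
    mul (mul x g) g⁻¹    S.≈⟨ S.*-congʳ {g⁻¹} eq ⟩
    mul (mul y g) g⁻¹    S.≈⟨ S.*-assoc y g g⁻¹ ⟩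
    mul y (mul g g⁻¹)    S.≈⟨ S.*-congˡ {y} inv ⟩
    mul y one            S.≈⟨ S.*-identityʳ y ⟩
    y                    S.∎

  mul-inverse : ∀ {f f⁻¹ g g⁻¹} → mul f f⁻¹ S.≈ one → mul g g⁻¹ S.≈ one →
    mul (mul f g) (mul f⁻¹ g⁻¹) S.≈ one
  mul-inverse {f} {f⁻¹} {g} {g⁻¹} p q = S.begin
    mul (mul f g) (mul f⁻¹ g⁻¹)  S.≈⟨ S.solve 4 (λ f f′ g g′ → (f S.:* g) S.:* (f′ S.:* g′)
                                       S.:= (f S.:* f′) S.:* (g S.:* g′)) S.refl f f⁻¹ g g⁻¹ ⟩
    mul (mul f f⁻¹) (mul g g⁻¹)  S.≈⟨ S.*-cong p q ⟩
    mul one one                  S.≈⟨ S.*-identityˡ one ⟩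
    one                          S.∎

  -- Dividing the vanishing Wronskian of u·g and v·h by the unit g·h leaves χ - φ = (u′v -
  -- uv′)/(uv), stated here without division or subtraction.
  wronskian-log : ∀ {g g⁻¹ h h⁻¹ φ χ} → mul g g⁻¹ S.≈ one → mul h h⁻¹ S.≈ one →
    ∂ g S.≈ mul φ g → ∂ h S.≈ mul χ h → ∀ u v →
    mul (mul u g) (∂ (mul v h)) S.≈ mul (∂ (mul u g)) (mul v h) →
    (mul (mul u v) χ S.+ mul u (∂ v)) S.≈ (mul (mul u v) φ S.+ mul (∂ u) v)
  wronskian-log {g} {g⁻¹} {h} {h⁻¹} {φ} {χ} gg⁻¹ hh⁻¹ ∂g ∂h u v eq =
    unit-cancelʳ X Y (mul-inverse {g} {g⁻¹} {h} {h⁻¹} gg⁻¹ hh⁻¹) (S.begin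
      mul X (mul g h)
        S.≈⟨ S.solve 6 (λ u g v′ h v χ → ((u S.:* v) S.:* χ S.:+ u S.:* v′) S.:* (g S.:* h)
               S.:= (u S.:* g) S.:* (v′ S.:* h S.:+ v S.:* (χ S.:* h))) S.refl u g (∂ v) h v χ ⟩
      mul (mul u g) (mul (∂ v) h S.+ mul v (mul χ h))
        S.≈⟨ S.*-congˡ {mul u g} (S.trans (∂-mul v h) (S.+-congˡ {mul (∂ v) h} (S.*-congˡ {v} ∂h))) ⟨
      mul (mul u g) (∂ (mul v h))
        S.≈⟨ eq ⟩
      mul (∂ (mul u g)) (mul v h)
        S.≈⟨ S.*-congʳ {mul v h} (S.trans (∂-mul u g) (S.+-congˡ {mul (∂ u) g} (S.*-congˡ {u} ∂g))) ⟩
      mul (mul (∂ u) g S.+ mul u (mul φ g)) (mul v h)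
        S.≈⟨ S.solve 6 (λ u g u′ h v φ → ((u S.:* v) S.:* φ S.:+ u′ S.:* v) S.:* (g S.:* h)
               S.:= (u′ S.:* g S.:+ u S.:* (φ S.:* g)) S.:* (v S.:* h)) S.refl u g (∂ u) h v φ ⟨
      mul Y (mul g h) S.∎)
    where
    X Y : ℕ → Carrier
    X = mul (mul u v) χ S.+ mul u (∂ v)
    Y = mul (mul u v) φ S.+ mul (∂ u) v

-- Relations in characteristic p

-- An overestimate of the total degree: the factor 1 of the constant monomial already
-- has length 1 rather than 0.
weight : ∀ {s} → Vec ℕ s → ℕ
weight []      = 1
weight (e ∷ v) = suc e ℕ.+ weight v

module PositiveCharacteristic {c ℓ : Level} (R : CommutativeRing c ℓ)
  (ν : ℕ → CommutativeRing.Carrier R)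
  (ν-zero : CommutativeRing._≈_ R (ν 0) (CommutativeRing.0# R))
  (ν-suc : ∀ n → CommutativeRing._≈_ R (ν (suc n))
                   (CommutativeRing._+_ R (CommutativeRing.1# R) (ν n)))
  (q : ℕ)
  (ν-p : ∀ n → CommutativeRing._≈_ R (ν (n ℕ.* suc q)) (CommutativeRing.0# R))
  (≈0? : ∀ x → Dec (CommutativeRing._≈_ R x (CommutativeRing.0# R)))
  (integral : ∀ x y → CommutativeRing._≈_ R (CommutativeRing._*_ R x y) (CommutativeRing.0# R) →
     CommutativeRing._≈_ R x (CommutativeRing.0# R) ⊎ CommutativeRing._≈_ R y (CommutativeRing.0# R))
  where

  open CommutativeRing R hiding (zero)
  open PowerSeries R ν ν-zero ν-suc public
  open Cartier q public
  open S using (solve; _:=_; _:+_; _:*_)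

  Series′ : Set c
  Series′ = ℕ → Carrier

  mul-cancel-unit : ∀ (f g : Series′) → ¬ f 0 ≈ 0# → mul f g S.≈ S.0# → g S.≈ S.0#
  mul-cancel-unit f g f₀≉0 fg≈0 zero with integral _ _ (fg≈0 0)
  ... | inj₁ f₀≈0 = contradiction f₀≈0 f₀≉0
  ... | inj₂ g₀≈0 = g₀≈0
  mul-cancel-unit f g f₀≉0 fg≈0 (suc n) = mul-cancel-unit f (tail g) f₀≉0
    (λ i → trans (sym (+-identityʳ _)) (trans
      (+-congˡ (sym (trans (*-congˡ (mul-cancel-unit f g f₀≉0 fg≈0 0)) (zeroʳ _))))
      (trans (sym (mul-sucʳ f g i)) (fg≈0 (suc i))))) n

  -- `n` bounds the search for the lowest nonzero coefficient of `f`: leading zeros are stripped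
  -- until `mul-cancel-unit` applies.
  mul-cancel : ∀ n (f g : Series′) → ¬ f n ≈ 0# → mul f g S.≈ S.0# → g S.≈ S.0#
  mul-cancel zero    f g fₙ≉0 fg≈0 = mul-cancel-unit f g fₙ≉0 fg≈0
  mul-cancel (suc n) f g fₙ≉0 fg≈0 with ≈0? (f 0)
  ... | no  f₀≉0 = mul-cancel-unit f g f₀≉0 fg≈0
  ... | yes f₀≈0 = mul-cancel n (tail f) g fₙ≉0 λ i →
        trans (sym (+-identityˡ _)) (trans
          (+-congʳ (sym (trans (*-congʳ f₀≈0) (zeroˡ _)))) (fg≈0 (suc i)))

  -- The form g = A·g(x^p) of the Lucas congruences. The length of A grows with p, but `M` can be
  -- chosen from the monomial alone.
  record Frobenius (M : ℕ) (g : Series′) : Set (c ⊔ ℓ) where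
    field
      {inverse} : Series′
      isInverse : mul g inverse S.≈ S.1#
      {factor}  : Series′
      frobenius : g S.≈ mul factor (σ g)
      length    : Length (M ℕ.* p) factor

  wronskian : Series′ → Series′ → Set ℓ
  wronskian f g = mul f (∂ g) S.≈ mul (∂ f) g

  module _ (M : ℕ) (M+2≤p : 2 ℕ.+ M ≤ p) where

    module _ {g : Series′} (F : Frobenius M g) where
      open Frobenius F

      unit-cancel : ∀ {f} → mul f g S.≈ S.0# → f S.≈ S.0#
      unit-cancel {f} fg≈0 = unit-cancelʳ {g} {inverse} f S.0# isInverse
        (S.trans fg≈0 (S.sym (S.zeroˡ g)))

      twist : ∀ f → mul f g S.≈ mul (mul f factor) (σ g)
      twist f = S.trans (S.*-congˡ {f} frobenius) (S.sym (S.*-assoc f factor (σ g)))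

      -- No inverse of the factor A is at hand, but f·A = 0 gives f·g = f·A·σ(g) = 0, and g is a
      -- unit.
      factor-cancel : ∀ f → mul f factor S.≈ S.0# → f S.≈ S.0#
      factor-cancel f eq = unit-cancel (S.trans (twist f) (S.trans (S.*-congʳ {σ g} eq) (S.zeroˡ (σ g))))

      -- f·A has length at most (M + 2 + t) + Mp, and a section divides lengths by p. As M + 2 ≤ p,
      -- one unit is gained. At length M + 1 the gain stops: A alone accounts for M, and any
      -- remainder for one more.
      Λ-length : ∀ t r f → Length (suc (suc M ℕ.+ t)) f → Length (suc M ℕ.+ t) (Λ r (mul f factor))
      Λ-length t r f len n L≤n = Length-mul len length (n ℕ.* p ℕ.+ r) (begin
        suc (suc M ℕ.+ t) ℕ.+ M ℕ.* p        ≤⟨ ℕ.+-monoˡ-≤ (M ℕ.* p) bound ⟩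
        suc t ℕ.* p ℕ.+ M ℕ.* p              ≡⟨ ℕ.*-distribʳ-+ p (suc t) M ⟨
        (suc t ℕ.+ M) ℕ.* p                  ≡⟨ ≡.cong (ℕ._* p) (≡.cong suc (ℕ.+-comm t M)) ⟩
        (suc M ℕ.+ t) ℕ.* p                  ≤⟨ ℕ.*-monoˡ-≤ p L≤n ⟩
        n ℕ.* p                              ≤⟨ ℕ.m≤m+n _ r ⟩
        n ℕ.* p ℕ.+ r                        ∎)
        where
        open ℕ.≤-Reasoning
        bound : suc (suc M ℕ.+ t) ≤ suc t ℕ.* p
        bound = begin
          2 ℕ.+ M ℕ.+ t          ≤⟨ ℕ.+-mono-≤ M+2≤p (≡.subst (_≤ t ℕ.* p) (ℕ.*-identityʳ t) (ℕ.*-monoʳ-≤ t (s≤s z≤n))) ⟩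
          p ℕ.+ t ℕ.* p          ∎

      ∂-twist : ∀ f → ∂ (mul f (σ g)) S.≈ mul (∂ f) (σ g)
      ∂-twist f = S.begin
        ∂ (mul f (σ g))                            S.≈⟨ ∂-mul f (σ g) ⟩
        mul (∂ f) (σ g) S.+ mul f (∂ (σ g))         S.≈⟨ S.+-congˡ {mul (∂ f) (σ g)} (S.*-congˡ {f} (∂-σ ν-p g)) ⟩
        mul (∂ f) (σ g) S.+ mul f S.0#              S.≈⟨ S.+-congˡ {mul (∂ f) (σ g)} (S.zeroʳ f) ⟩
        mul (∂ f) (σ g) S.+ S.0#                    S.≈⟨ S.+-identityʳ (mul (∂ f) (σ g)) ⟩
        mul (∂ f) (σ g)                            S.∎

    -- Sections strip `σ` off again, so that a relation between the `σ (g k)` yields relations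
    -- between the `g k`, to which the induction applies.
    Λ-relation : ∀ {N} (g d : Fin N → Series′) → sum (λ k → mul (d k) (σ (g k))) S.≈ S.0# →
      ∀ r → r < p → sum (λ k → mul (Λ r (d k)) (g k)) S.≈ S.0#
    Λ-relation g d rel r r<p = S.begin
      sum (λ k → mul (Λ r (d k)) (g k))
        S.≈⟨ sum-cong (λ k → S.begin
              mul (Λ r (d k)) (g k)      S.≈⟨ S.*-comm (Λ r (d k)) (g k) ⟩
              mul (g k) (Λ r (d k))      S.≈⟨ Λ-mul r r<p (g k) (d k) ⟨
              Λ r (mul (σ (g k)) (d k))  S.≈⟨ (λ n → S.*-comm (σ (g k)) (d k) (n ℕ.* p ℕ.+ r)) ⟩
              Λ r (mul (d k) (σ (g k)))  S.∎) ⟩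
      sum (λ k → Λ r (mul (d k) (σ (g k))))
        S.≈⟨ (λ n → Λ-sum (λ k → mul (d k) (σ (g k))) n) ⟨
      Λ r (sum (λ k → mul (d k) (σ (g k))))
        S.≈⟨ (λ n → rel (n ℕ.* p ℕ.+ r)) ⟩
      S.0# S.∎
      where
      Λ-sum : ∀ {N} (h : Fin N → Series′) → Λ r (sum h) S.≈ sum (Λ r ∘ h)
      Λ-sum {zero}  h n = refl
      Λ-sum {suc N} h n = +-congˡ (Λ-sum (h ∘ suc) n)

    -- N plays the role of − D₀, as the solver only knows semiring identities.
    eliminate : ∀ d₀ D₀ G₀ N X Y → (N S.+ D₀) S.≈ S.0# →
      (mul d₀ G₀ S.+ X) S.≈ S.0# → (mul D₀ G₀ S.+ Y) S.≈ S.0# →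
      (mul d₀ Y S.+ mul N X) S.≈ S.0#
    eliminate d₀ D₀ G₀ N X Y N+D₀≈0 eq₁ eq₂ = S.begin
      mul d₀ Y S.+ mul N X
        S.≈⟨ S.+-identityʳ (mul d₀ Y S.+ mul N X) ⟨
      (mul d₀ Y S.+ mul N X) S.+ S.0#
        S.≈⟨ S.+-congˡ {mul d₀ Y S.+ mul N X} (S.zeroˡ (mul d₀ G₀)) ⟨
      (mul d₀ Y S.+ mul N X) S.+ mul S.0# (mul d₀ G₀)
        S.≈⟨ S.+-congˡ {mul d₀ Y S.+ mul N X} (S.*-congʳ {mul d₀ G₀} N+D₀≈0) ⟨
      (mul d₀ Y S.+ mul N X) S.+ mul (N S.+ D₀) (mul d₀ G₀)
        S.≈⟨ solve 6 (λ d D G n x y → (d :* y :+ n :* x) :+ (n :+ D) :* (d :* G)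
               := d :* (D :* G :+ y) :+ n :* (d :* G :+ x)) S.refl d₀ D₀ G₀ N X Y ⟩
      mul d₀ (mul D₀ G₀ S.+ Y) S.+ mul N (mul d₀ G₀ S.+ X)
        S.≈⟨ S.+-cong (S.*-congˡ {d₀} eq₂) (S.*-congˡ {N} eq₁) ⟩
      mul d₀ S.0# S.+ mul N S.0#
        S.≈⟨ S.+-cong (S.zeroʳ d₀) (S.zeroʳ N) ⟩
      S.0# S.+ S.0#
        S.≈⟨ S.+-identityˡ S.0# ⟩
      S.0# S.∎

    -- Applying Λ to a relation decreases t; at t = 0 the derivative argument applies.
    independent : ∀ N t (g : Fin N → Series′) → (∀ k → Frobenius M (g k)) →
      (∀ k l → k ≢ l → ∀ u v → Length (suc M) u → Length (suc M) v →
        wronskian (mul u (g k)) (mul v (g l)) → mul u v S.≈ S.0#) →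
      ∀ (c : Fin N → Series′) → (∀ k → Length (suc M ℕ.+ t) (c k)) → sum (λ k → mul (c k) (g k)) S.≈ S.0# →
      ∀ k → c k S.≈ S.0#
    independent zero t g F nondegenerate c len rel ()
    -- All sections of c k·A k vanish by induction; together they determine c k·A k, and the factor
    -- A k cancels.
    independent (suc N) (suc t) g F nondegenerate c len rel k = factor-cancel (F k) (c k)
      (Λ-ext λ r r<p → independent (suc N) t g F nondegenerate (λ k → Λ r (d k))
        (λ k → Λ-length (F k) t r (c k) (≡.subst (λ L → Length L (c k)) (ℕ.+-suc (suc M) t) (len k)))
        (Λ-relation g d (S.trans (S.sym (sum-cong λ k → twist (F k) (c k))) rel) r r<p) k)
      where
      d : Fin (suc N) → Series′
      d k = mul (c k) (Frobenius.factor (F k))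
    independent (suc N) zero g F nondegenerate c len rel = λ where
        zero    → c₀≈0
        (suc k) → independent-tail (suc M ℕ.+ 0) (c ∘ suc) (len ∘ suc) tail-rel k
      where
      -- With one monomial fewer any length is allowed: `L` itself becomes the new `t`. Thus the
      -- growth of degrees under elimination does no harm.
      independent-tail : ∀ L (b : Fin N → Series′) → (∀ k → Length L (b k)) →
        sum (λ k → mul (b k) (g (suc k))) S.≈ S.0# → ∀ k → b k S.≈ S.0#
      independent-tail L b len = independent N L (g ∘ suc) (F ∘ suc)
        (λ k l k≢l → nondegenerate (suc k) (suc l) (k≢l ∘ λ { ≡.refl → ≡.refl })) b
        (λ k → Length-≤ (ℕ.m≤n+m L (suc M)) (len k))

      d : Fin (suc N) → Series′
      d k = mul (c k) (Frobenius.factor (F k))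

      d₀ D₀ : Series′
      d₀ = d zero
      D₀ = ∂ d₀

      d-rel : sum (λ k → mul (d k) (σ (g k))) S.≈ S.0#
      d-rel = S.trans (S.sym (sum-cong λ k → twist (F k) (c k))) rel

      ∂d-rel : sum (λ k → mul (∂ (d k)) (σ (g k))) S.≈ S.0#
      ∂d-rel = S.begin
        sum (λ k → mul (∂ (d k)) (σ (g k)))   S.≈⟨ sum-cong (λ k → ∂-twist (F k) (d k)) ⟨
        sum (λ k → ∂ (mul (d k) (σ (g k))))   S.≈⟨ ∂-sum (λ k → mul (d k) (σ (g k))) ⟨
        ∂ (sum (λ k → mul (d k) (σ (g k))))   S.≈⟨ ∂-cong d-rel ⟩
        ∂ S.0#                               S.≈⟨ ∂-0 ⟩
        S.0#                                 S.∎

      -- The coefficients of d₀ times `∂d-rel` minus D₀ times `d-rel`, where σ(g₀) has cancelled: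
      -- the Wronskians of d₀ and the other d k.
      e : Fin N → Series′
      e k = mul d₀ (∂ (d (suc k))) S.+ mul (S.- D₀) (d (suc k))

      e-rel : sum (λ k → mul (e k) (σ (g (suc k)))) S.≈ S.0#
      e-rel = S.begin
        sum (λ k → mul (e k) (G k))
          S.≈⟨ sum-cong (λ k → solve 5 (λ a b x y z → (a :* b :+ x :* y) :* z := a :* (b :* z) :+ x :* (y :* z))
                 S.refl d₀ (∂ (d (suc k))) (S.- D₀) (d (suc k)) (G k)) ⟩
        sum (λ k → mul d₀ (mul (∂ (d (suc k))) (G k)) S.+ mul (S.- D₀) (mul (d (suc k)) (G k)))
          S.≈⟨ sum-+ (λ k → mul d₀ (mul (∂ (d (suc k))) (G k))) (λ k → mul (S.- D₀) (mul (d (suc k)) (G k))) ⟩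
        sum (λ k → mul d₀ (mul (∂ (d (suc k))) (G k))) S.+ sum (λ k → mul (S.- D₀) (mul (d (suc k)) (G k)))
          S.≈⟨ S.+-cong (*-distribˡ-sum d₀ (λ k → mul (∂ (d (suc k))) (G k)))
                        (*-distribˡ-sum (S.- D₀) (λ k → mul (d (suc k)) (G k))) ⟨
        mul d₀ (sum (λ k → mul (∂ (d (suc k))) (G k))) S.+ mul (S.- D₀) (sum (λ k → mul (d (suc k)) (G k)))
          S.≈⟨ eliminate d₀ D₀ (σ (g zero)) (S.- D₀) (sum (λ k → mul (d (suc k)) (G k)))
                 (sum (λ k → mul (∂ (d (suc k))) (G k))) (S.-‿inverseˡ D₀) d-rel ∂d-rel ⟩
        S.0# S.∎
        where
        G : Fin N → Series′
        G k = σ (g (suc k))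

      E : ℕ
      E = (suc M ℕ.+ 0) ℕ.+ M ℕ.* p

      d-length : ∀ k → Length E (d k)
      d-length k = Length-mul (len k) (Frobenius.length (F k))

      -- The division of the length by p is given away here, since `independent-tail` takes any
      -- bound.
      Λe-length : ∀ r k → Length (E ℕ.+ E) (Λ r (e k))
      Λe-length r k n E≤n = Length-+ {f = mul d₀ (∂ (d (suc k)))} {g = mul (S.- D₀) (d (suc k))}
        (Length-mul (d-length zero) (Length-∂ (d-length (suc k))))
        (Length-mul (Length-neg (Length-∂ (d-length zero))) (d-length (suc k)))
        (n ℕ.* p ℕ.+ r)
        (ℕ.≤-trans E≤n (ℕ.≤-trans (ℕ.m≤m*n n p) (ℕ.m≤m+n _ r)))

      e≈0 : ∀ k → e k S.≈ S.0#
      e≈0 k = Λ-ext λ r r<p → independent-tail (E ℕ.+ E) (λ k → Λ r (e k)) (Λe-length r)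
        (Λ-relation (g ∘ suc) e e-rel r r<p) k

      d-wronskian : ∀ k → wronskian d₀ (d (suc k))
      d-wronskian k = S.begin
        x                                    S.≈⟨ S.+-identityʳ x ⟨
        x S.+ S.0#                           S.≈⟨ S.+-congˡ {x} (S.zeroˡ (d (suc k))) ⟨
        x S.+ mul S.0# (d (suc k))           S.≈⟨ S.+-congˡ {x} (S.*-congʳ {d (suc k)} (S.-‿inverseˡ D₀)) ⟨
        x S.+ mul ((S.- D₀) S.+ D₀) (d (suc k))
          S.≈⟨ solve 4 (λ x n D y → x :+ (n :+ D) :* y := (x :+ n :* y) :+ D :* y)
                 S.refl x (S.- D₀) D₀ (d (suc k)) ⟩
        e k S.+ mul D₀ (d (suc k))           S.≈⟨ S.+-congʳ {mul D₀ (d (suc k))} (e≈0 k) ⟩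
        S.0# S.+ mul D₀ (d (suc k))          S.≈⟨ S.+-identityˡ (mul D₀ (d (suc k))) ⟩
        mul D₀ (d (suc k))                   S.∎
        where
        x : Series′
        x = mul d₀ (∂ (d (suc k)))

      ∂cg : ∀ k → ∂ (mul (c k) (g k)) S.≈ mul (∂ (d k)) (σ (g k))
      ∂cg k = S.trans (∂-cong (twist (F k) (c k))) (∂-twist (F k) (d k))

      -- c k·g k = d k·σ(g k), and σ(g k) acts as a constant under `∂`. So this Wronskian is that of
      -- the d k times σ(g₀)·σ(g k).
      cg-wronskian : ∀ k → wronskian (mul (c zero) (g zero)) (mul (c (suc k)) (g (suc k)))
      cg-wronskian k = S.begin
        mul (mul (c zero) (g zero)) (∂ (mul (c (suc k)) (g (suc k))))
          S.≈⟨ S.*-cong (twist (F zero) (c zero)) (∂cg (suc k)) ⟩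
        mul (mul d₀ G₀) (mul (∂ (d (suc k))) G)
          S.≈⟨ solve 4 (λ a b x y → (a :* b) :* (x :* y) := (a :* x) :* (b :* y)) S.refl d₀ G₀ (∂ (d (suc k))) G ⟩
        mul (mul d₀ (∂ (d (suc k)))) (mul G₀ G)
          S.≈⟨ S.*-congʳ {mul G₀ G} (d-wronskian k) ⟩
        mul (mul D₀ (d (suc k))) (mul G₀ G)
          S.≈⟨ solve 4 (λ a b x y → (a :* b) :* (x :* y) := (a :* x) :* (b :* y)) S.refl D₀ (d (suc k)) G₀ G ⟩
        mul (mul D₀ G₀) (mul (d (suc k)) G)
          S.≈⟨ S.*-cong (∂cg zero) (twist (F (suc k)) (c (suc k))) ⟨
        mul (∂ (mul (c zero) (g zero))) (mul (c (suc k)) (g (suc k))) S.∎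
        where
        G₀ G : Series′
        G₀ = σ (g zero)
        G  = σ (g (suc k))

      c-length : ∀ k → Length (suc M) (c k)
      c-length k = ≡.subst (λ L → Length L (c k)) (ℕ.+-identityʳ (suc M)) (len k)

      -- If c₀ had a nonzero coefficient, nondegeneracy would annihilate all other c k, leaving
      -- c₀·g₀ = 0 with g₀ a unit.
      c₀≈0 : c zero S.≈ S.0#
      c₀≈0 n with ≈0? (c zero n)
      ... | yes c₀ₙ≈0 = c₀ₙ≈0
      ... | no  c₀ₙ≉0 = unit-cancel (F zero) (S.begin
        mul (c zero) (g zero)
          S.≈⟨ S.+-identityʳ (mul (c zero) (g zero)) ⟨
        mul (c zero) (g zero) S.+ S.0#
          S.≈⟨ S.+-congˡ {mul (c zero) (g zero)} (sum-0 (λ k → mul (c (suc k)) (g (suc k))) λ k →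
                 S.trans (S.*-congʳ {g (suc k)} (mul-cancel n (c zero) (c (suc k)) c₀ₙ≉0
                   (nondegenerate zero (suc k) (λ ()) (c zero) (c (suc k)) (c-length zero)
                     (c-length (suc k)) (cg-wronskian k)))) (S.zeroˡ (g (suc k)))) ⟨
        sum (λ k → mul (c k) (g k))
          S.≈⟨ rel ⟩
        S.0# S.∎) n

      tail-rel : sum (λ k → mul (c (suc k)) (g (suc k))) S.≈ S.0#
      tail-rel = S.begin
        X                                          S.≈⟨ S.+-identityˡ X ⟨
        S.0# S.+ X                                 S.≈⟨ S.+-congʳ {X} (S.trans (S.*-congʳ {g zero} c₀≈0) (S.zeroˡ (g zero))) ⟨
        mul (c zero) (g zero) S.+ X                S.≈⟨ rel ⟩
        S.0#                                       S.∎
        where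
        X : Series′
        X = sum (λ k → mul (c (suc k)) (g (suc k)))

  Frobenius-≤ : ∀ {M M′ g} → M ≤ M′ → Frobenius M g → Frobenius M′ g
  Frobenius-≤ M≤M′ F = record
    { isInverse = Frobenius.isInverse F
    ; frobenius = Frobenius.frobenius F
    ; length    = Length-≤ (ℕ.*-monoˡ-≤ p M≤M′) (Frobenius.length F)
    }

  Frobenius-mul : ∀ {M M′ g h} → Frobenius M g → Frobenius M′ h → Frobenius (M ℕ.+ M′) (mul g h)
  Frobenius-mul {M} {M′} {g} {h} F H = record
    { isInverse = mul-inverse {g} {F.inverse} {h} {H.inverse} F.isInverse H.isInverse
    ; factor    = mul F.factor H.factor
    ; frobenius = S.begin
        mul g h
          S.≈⟨ S.*-cong F.frobenius H.frobenius ⟩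
        mul (mul F.factor (σ g)) (mul H.factor (σ h))
          S.≈⟨ solve 4 (λ a g b h → (a :* g) :* (b :* h) := (a :* b) :* (g :* h))
                 S.refl F.factor (σ g) H.factor (σ h) ⟩
        mul (mul F.factor H.factor) (mul (σ g) (σ h))
          S.≈⟨ S.*-congˡ {mul F.factor H.factor} (σ-mul g h) ⟨
        mul (mul F.factor H.factor) (σ (mul g h)) S.∎
    ; length    = ≡.subst (λ L → Length L (mul F.factor H.factor)) (≡.sym (ℕ.*-distribʳ-+ p M M′))
        (Length-mul F.length H.length)
    }
    where
    module F = Frobenius F
    module H = Frobenius H

  Frobenius-one : Frobenius 1 one
  Frobenius-one = record
    { isInverse = S.*-identityˡ one
    ; factor    = one
    ; frobenius = S.sym (S.trans (S.*-identityˡ (σ one)) σ-one)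
    ; length    = Length-≤ (s≤s z≤n) Length-one
    }

  Frobenius-pow : ∀ {f} → Frobenius 1 f → ∀ e → Frobenius (suc e) (pow f e)
  Frobenius-pow F zero    = Frobenius-one
  Frobenius-pow F (suc e) = Frobenius-mul F (Frobenius-pow F e)

  Frobenius-monomial : ∀ {s} {f : Fin s → Series′} → (∀ i → Frobenius 1 (f i)) →
    ∀ v → Frobenius (weight v) (monomial f v)
  Frobenius-monomial F []      = Frobenius-one
  Frobenius-monomial F (e ∷ v) = Frobenius-mul (Frobenius-pow (F zero) e) (Frobenius-monomial (F ∘ suc) v)

  -- The product is u′v - uv′ by `wronskian-log`, so its length is controlled by `u` and `v`,
  -- whatever p is. It suffices to look at indices from 2M on, where u′v and uv′ vanish.
  log-difference-rational : ∀ {M g g⁻¹ h h⁻¹ φ χ} → mul g g⁻¹ S.≈ one → mul h h⁻¹ S.≈ one →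
    ∂ g S.≈ mul φ g → ∂ h S.≈ mul χ h → ∀ u v → Length M u → Length M v →
    wronskian (mul u g) (mul v h) → Length (M ℕ.+ M) (mul (mul u v) (χ S.- φ))
  log-difference-rational {M} {g} {g⁻¹} {h} {h⁻¹} {φ} {χ} gg⁻¹ hh⁻¹ ∂g ∂h u v len-u len-v eq n M≤n =
    trans (S.distribˡ (mul u v) χ (S.- φ) n) (trans (+-congʳ χ≈φ)
      (trans (sym (S.distribˡ (mul u v) φ (S.- φ) n))
        (trans (S.*-congˡ {mul u v} (S.-‿inverseʳ φ) n) (S.zeroʳ (mul u v) n))))
    where
    χ≈φ : mul (mul u v) χ n ≈ mul (mul u v) φ n
    χ≈φ = trans (sym (trans (+-congˡ (Length-mul len-u (Length-∂ len-v) n M≤n)) (+-identityʳ _)))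
      (trans (wronskian-log {g} {g⁻¹} {h} {h⁻¹} gg⁻¹ hh⁻¹ ∂g ∂h u v eq n)
        (trans (+-congˡ (Length-mul (Length-∂ len-u) len-v n M≤n)) (+-identityʳ _)))

-- Reduction modulo large primes

open ≡ using (refl)

upper-bound : ∀ {N} (h : Fin N → ℕ) → ∃ λ M → ∀ k → h k ≤ M
upper-bound {zero}  h = 0 , λ ()
upper-bound {suc N} h with upper-bound (h ∘ suc)
... | M , rest = h zero ℕ.⊔ M , λ where
  zero    → ℕ.m≤m⊔n _ M
  (suc k) → ℕ.≤-trans (rest k) (ℕ.m≤n⊔m (h zero) M)

n∣n! : ∀ n .{{_ : ℕ.NonZero n}} → n ℕ.∣ n !
n∣n! (suc n) = ℕ.m∣m*n (n !)

-- Euclid: a prime factor of n! + 1 exceeds n.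
prime-above : ∀ n → ∃ λ p → Prime p × n < p
prime-above n with factorise (suc (n !))
... | record { factors = [] ; isFactorisation = eq } =
  contradiction (ℕ.suc-injective eq) (ℕ.≢-nonZero⁻¹ (n !) {{n ℕ.!≢0}})
... | record { factors = p ∷ ps ; isFactorisation = eq ; factorsPrime = p-prime ∷ _ } =
  p , p-prime , ℕ.≰⇒> λ p≤n → ℕ.nonTrivial⇒≢1 {{prime⇒nonTrivial p-prime}} (ℕ.∣1⇒≡1
    (ℕ.∣m+n∣m⇒∣n (≡.subst (p ℕ.∣_) (≡.trans (≡.sym eq) (ℕ.+-comm 1 (n !))) (ℕ.m∣m*n _))
      (ℕ.∣-trans (n∣n! p {{prime⇒nonZero p-prime}}) (ℕ.m≤n⇒m!∣n! p≤n))))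

small-not-divisible : ∀ {p z} → z ≢ ℤ.0ℤ → ℤ.∣ z ∣ < p → ¬ + p ∣ z
small-not-divisible z≢0 ∣z∣<p p∣z =
  ℕ.>⇒∤ {{ℤ.≢-nonZero z≢0}} ∣z∣<p (∣⇒∣ᵤ p∣z)

prime∣* : ∀ {p} → Prime p → ∀ x y → + p ∣ x ℤ.* y → (+ p ∣ x) ⊎ (+ p ∣ y)
prime∣* {p} p-prime x y p∣xy = Sum.map ∣ᵤ⇒∣ ∣ᵤ⇒∣
  (euclidsLemma ℤ.∣ x ∣ ℤ.∣ y ∣ p-prime (≡.subst (p ℕ.∣_) (ℤ.abs-* x y) (∣⇒∣ᵤ p∣xy)))

ℤ-ring : CommutativeRing 0ℓ 0ℓ
ℤ-ring = ℤ.+-*-commutativeRing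

module ℤ-Series = PowerSeries ℤ-ring +_ refl (λ _ → refl)

module Modulo (p : ℕ) where

  infix 4 _≈_
  -- A record keeps `x` and `y` recoverable from the type, unlike the bare divisibility of their
  -- difference.
  record _≈_ (x y : ℤ) : Set where
    constructor mod
    field divisible : + p ∣ x ℤ.- y

  ≡⇒≈ : ∀ {x y} → x ≡ y → x ≈ y
  ≡⇒≈ {x} refl = mod (divides ℤ.0ℤ (ℤ.+-inverseʳ x))

  ∣⇒≈0 : ∀ {x} → + p ∣ x → x ≈ ℤ.0ℤ
  ∣⇒≈0 {x} p∣x = mod (≡.subst (+ p ∣_) (≡.sym (ℤ.+-identityʳ x)) p∣x)

  ≈0⇒∣ : ∀ {x} → x ≈ ℤ.0ℤ → + p ∣ x
  ≈0⇒∣ {x} (mod p∣x) = ≡.subst (+ p ∣_) (ℤ.+-identityʳ x) p∣x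

  ≈-sym : ∀ {x y} → x ≈ y → y ≈ x
  ≈-sym {x} {y} (mod x≈y) = mod (≡.subst (+ p ∣_) (swap x y) (∣m⇒∣-m x≈y))
    where
    swap : ∀ x y → ℤ.- (x ℤ.- y) ≡ y ℤ.- x
    swap = solve-∀

  ≈-trans : ∀ {x y z} → x ≈ y → y ≈ z → x ≈ z
  ≈-trans {x} {y} {z} (mod x≈y) (mod y≈z) = mod (≡.subst (+ p ∣_) (telescope x y z) (∣m∣n⇒∣m+n x≈y y≈z))
    where
    telescope : ∀ x y z → (x ℤ.- y) ℤ.+ (y ℤ.- z) ≡ x ℤ.- z
    telescope = solve-∀

  +-cong : ∀ {x y u v} → x ≈ y → u ≈ v → x ℤ.+ u ≈ y ℤ.+ v
  +-cong {x} {y} {u} {v} (mod x≈y) (mod u≈v) = mod (≡.subst (+ p ∣_) (regroup x y u v) (∣m∣n⇒∣m+n x≈y u≈v))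
    where
    regroup : ∀ x y u v → (x ℤ.- y) ℤ.+ (u ℤ.- v) ≡ (x ℤ.+ u) ℤ.- (y ℤ.+ v)
    regroup = solve-∀

  neg-cong : ∀ {x y} → x ≈ y → ℤ.- x ≈ ℤ.- y
  neg-cong {x} {y} (mod x≈y) = mod (≡.subst (+ p ∣_) (regroup x y) (∣m⇒∣-m x≈y))
    where
    regroup : ∀ x y → ℤ.- (x ℤ.- y) ≡ ℤ.- x ℤ.- ℤ.- y
    regroup = solve-∀

  *-cong : ∀ {x y u v} → x ≈ y → u ≈ v → x ℤ.* u ≈ y ℤ.* v
  *-cong {x} {y} {u} {v} (mod x≈y) (mod u≈v) = mod (≡.subst (+ p ∣_) (regroup x y u v)
    (∣m∣n⇒∣m+n (∣n⇒∣m*n u x≈y) (∣n⇒∣m*n y u≈v)))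
    where
    regroup : ∀ x y u v → u ℤ.* (x ℤ.- y) ℤ.+ y ℤ.* (u ℤ.- v) ≡ x ℤ.* u ℤ.- y ℤ.* v
    regroup = solve-∀

  ring : CommutativeRing 0ℓ 0ℓ
  ring = record
    { Carrier = ℤ
    ; _≈_ = _≈_
    ; _+_ = ℤ._+_
    ; _*_ = ℤ._*_
    ; -_  = ℤ.-_
    ; 0#  = ℤ.0ℤ
    ; 1#  = ℤ.1ℤ
    ; isCommutativeRing = record
      { isRing = record
        { +-isAbelianGroup = record
          { isGroup = record
            { isMonoid = record
              { isSemigroup = record
                { isMagma = record
                  { isEquivalence = record { refl = ≡⇒≈ refl ; sym = ≈-sym ; trans = ≈-trans }
                  ; ∙-cong = +-cong }
                ; assoc = λ x y z → ≡⇒≈ (ℤ.+-assoc x y z) }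
              ; identity = (λ x → ≡⇒≈ (ℤ.+-identityˡ x)) , (λ x → ≡⇒≈ (ℤ.+-identityʳ x)) }
            ; inverse = (λ x → ≡⇒≈ (ℤ.+-inverseˡ x)) , (λ x → ≡⇒≈ (ℤ.+-inverseʳ x))
            ; ⁻¹-cong = neg-cong }
          ; comm = λ x y → ≡⇒≈ (ℤ.+-comm x y) }
        ; *-cong = *-cong
        ; *-assoc = λ x y z → ≡⇒≈ (ℤ.*-assoc x y z)
        ; *-identity = (λ x → ≡⇒≈ (ℤ.*-identityˡ x)) , (λ x → ≡⇒≈ (ℤ.*-identityʳ x))
        ; distrib = (λ x y z → ≡⇒≈ (ℤ.*-distribˡ-+ x y z)) , (λ x y z → ≡⇒≈ (ℤ.*-distribʳ-+ x y z)) }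
      ; *-comm = λ x y → ≡⇒≈ (ℤ.*-comm x y) } }

module ModuloPrime (q : ℕ) (p-prime : Prime (suc q)) where

  open Modulo (suc q) public using (ring; ≡⇒≈; ∣⇒≈0; ≈0⇒∣)

  open PositiveCharacteristic ring +_ (≡⇒≈ {ℤ.0ℤ} refl) (λ n → ≡⇒≈ {+ suc n} refl) q
    (λ n → ∣⇒≈0 (divides (+ n) (ℤ.pos-* n (suc q))))
    (λ x → Dec.map′ ∣⇒≈0 ≈0⇒∣ (+ suc q ∣? x))
    (λ x y xy≈0 → Sum.map ∣⇒≈0 ∣⇒≈0 (prime∣* p-prime x y (≈0⇒∣ xy≈0)))
    public

-- Integer linear algebra modulo large primes

dot : ∀ {d} → Vec ℤ d → Vec ℤ d → ℤ
dot []       v = ℤ.0ℤ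
dot (b ∷ bs) v = b ℤ.* head v ℤ.+ dot bs (Vec.tail v)

dot-zero : ∀ {d} (v : Vec ℤ d) → dot (replicate d ℤ.0ℤ) v ≡ ℤ.0ℤ
dot-zero []      = refl
dot-zero (x ∷ v) = ≡.trans (ℤ.+-identityˡ _) (dot-zero v)

dot-map : ∀ {d} α (b v : Vec ℤ d) → dot (map (α ℤ.*_) b) v ≡ α ℤ.* dot b v
dot-map α []       v = ≡.sym (ℤ.*-zeroʳ α)
dot-map α (b ∷ bs) v = ≡.trans (≡.cong₂ ℤ._+_ {α ℤ.* b ℤ.* head v} refl (dot-map α bs (Vec.tail v)))
  (factor α b (head v) (dot bs (Vec.tail v)))
  where
  factor : ∀ α b x y → α ℤ.* b ℤ.* x ℤ.+ α ℤ.* y ≡ α ℤ.* (b ℤ.* x ℤ.+ y)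
  factor = solve-∀

dot-combination : ∀ {d} α β (b u v : Vec ℤ d) →
  dot b (zipWith (λ x y → α ℤ.* x ℤ.- β ℤ.* y) u v) ≡ α ℤ.* dot b u ℤ.- β ℤ.* dot b v
dot-combination α β []       u       v       = zero′ α β
  where
  zero′ : ∀ α β → ℤ.0ℤ ≡ α ℤ.* ℤ.0ℤ ℤ.- β ℤ.* ℤ.0ℤ
  zero′ = solve-∀
dot-combination α β (b ∷ bs) (x ∷ u) (y ∷ v) =
  ≡.trans (≡.cong₂ ℤ._+_ {b ℤ.* (α ℤ.* x ℤ.- β ℤ.* y)} refl (dot-combination α β bs u v)) (regroup α β b x y (dot bs u) (dot bs v))
  where
  regroup : ∀ α β b x y X Y → b ℤ.* (α ℤ.* x ℤ.- β ℤ.* y) ℤ.+ (α ℤ.* X ℤ.- β ℤ.* Y)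
    ≡ α ℤ.* (b ℤ.* x ℤ.+ X) ℤ.- β ℤ.* (b ℤ.* y ℤ.+ Y)
  regroup = solve-∀

-- The vectors w n eliminate each other's first coordinate against a pivot w m;
-- modulo a prime that divides no pivot, the elimination works as it does over ℚ.
trivial-kernel-mod-large-primes : ∀ d (w : ℕ → Vec ℤ d) →
  (∀ b → VecAny.Any (_≢ ℤ.0ℤ) b → ¬ (∀ n → dot b (w n) ≡ ℤ.0ℤ)) →
  ¬ ¬ ∃ λ n₀ → ∀ p → Prime p → n₀ < p →
    ∀ b → (∀ n → + p ∣ dot b (w n)) → VecAll.All (+ p ∣_) b
trivial-kernel-mod-large-primes zero    w trivial k = k (0 , λ { p _ _ [] _ → [] })
trivial-kernel-mod-large-primes (suc d) w trivial k =
  -- If no `w n` had a nonzero first coordinate, the first unit vector would lie in the kernel. A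
  -- pivot cannot be searched for along an infinite sequence, hence the double negation.
  trivial (ℤ.1ℤ ∷ replicate d ℤ.0ℤ) (here λ ()) λ n →
    ≡.trans (≡.cong₂ ℤ._+_ {ℤ.1ℤ ℤ.* head (w n)} refl (dot-zero (Vec.tail (w n))))
      (≡.trans (ℤ.+-identityʳ _) (≡.trans (ℤ.*-identityˡ (head (w n)))
        (decidable-stable (head (w n) ℤ.≟ ℤ.0ℤ) (pivot n))))
  where
  pivot : ∀ m → ¬ head (w m) ≢ ℤ.0ℤ
  pivot m α≢0 = trivial-kernel-mod-large-primes d w′ trivial′ λ where
      -- p > |α| keeps the pivot invertible modulo p.
      (n₀ , large) → k (n₀ ℕ.⊔ ℤ.∣ α ∣ , λ where
        p p-prime n₀<p (b₀ ∷ b) p∣ →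
          let p∤α : ¬ + p ∣ α
              p∤α = small-not-divisible α≢0 (ℕ.m⊔n<o⇒n<o n₀ _ n₀<p)
              rest : VecAll.All (+ p ∣_) b
              rest = large p p-prime (ℕ.m⊔n<o⇒m<o n₀ _ n₀<p) b λ n →
                ≡.subst (+ p ∣_) (≡.trans (combine α b₀ (head (w n)) (dot b (Vec.tail (w n))) (dot b (Vec.tail (w m))))
                    (≡.sym (dot-combination α (head (w n)) b (Vec.tail (w n)) (Vec.tail (w m)))))
                  (∣m∣n⇒∣m-n (∣n⇒∣m*n α (p∣ n)) (∣n⇒∣m*n (head (w n)) (p∣ m)))
              first : + p ∣ b₀ ℤ.* α
              first = ∣m+n∣n⇒∣m (p∣ m) (∣dot rest)
          in Sum.fromInj₁ (λ p∣α → contradiction p∣α p∤α) (prime∣* p-prime b₀ α first) ∷ rest)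
    where
    α : ℤ
    α = head (w m)

    w′ : ℕ → Vec ℤ d
    w′ n = zipWith (λ x y → α ℤ.* x ℤ.- head (w n) ℤ.* y) (Vec.tail (w n)) (Vec.tail (w m))

    combine : ∀ α b h X Y → α ℤ.* (b ℤ.* h ℤ.+ X) ℤ.- h ℤ.* (b ℤ.* α ℤ.+ Y) ≡ α ℤ.* X ℤ.- h ℤ.* Y
    combine = solve-∀

    ∣dot : ∀ {p d} {b v : Vec ℤ d} → VecAll.All (p ∣_) b → p ∣ dot b v
    ∣dot {v = v}     []         = divides ℤ.0ℤ refl
    ∣dot {v = x ∷ v} (p∣b ∷ ps) = ∣m∣n⇒∣m+n (∣m⇒∣m*n x p∣b) (∣dot ps)

    scale-nonzero : ∀ {d} {b : Vec ℤ d} → VecAny.Any (_≢ ℤ.0ℤ) b → VecAny.Any (_≢ ℤ.0ℤ) (map (α ℤ.*_) b)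
    scale-nonzero (here b≢0) = here λ αb≡0 → Sum.[ α≢0 , b≢0 ]′ (ℤ.i*j≡0⇒i≡0∨j≡0 α αb≡0)
    scale-nonzero (there p)  = there (scale-nonzero p)

    -- A kernel vector `b` of the eliminated family extends to one of `w`: once `b` is scaled by α,
    -- the equation of the pivot row forces the first coordinate, which is integral.
    trivial′ : ∀ b → VecAny.Any (_≢ ℤ.0ℤ) b → ¬ (∀ n → dot b (w′ n) ≡ ℤ.0ℤ)
    trivial′ b b≢0 kills = trivial (ℤ.- dot b (Vec.tail (w m)) ∷ map (α ℤ.*_) b)
      (there (scale-nonzero b≢0)) λ n →
        ≡.trans (≡.cong₂ ℤ._+_ {ℤ.- dot b (Vec.tail (w m)) ℤ.* head (w n)} refl (dot-map α b (Vec.tail (w n))))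
          (≡.trans (swap α (head (w n)) (dot b (Vec.tail (w n))) (dot b (Vec.tail (w m))))
            (≡.trans (≡.sym (dot-combination α (head (w n)) b (Vec.tail (w n)) (Vec.tail (w m))))
              (kills n)))
      where
      swap : ∀ α h X Y → ℤ.- Y ℤ.* h ℤ.+ α ℤ.* X ≡ α ℤ.* X ℤ.- h ℤ.* Y
      swap = solve-∀

-- Rationality of integer series as a linear condition

module _ where
  open ℤ-Series using (mul; one; ∂; sum; monomial; exponents·_)

  vecToSeries : ∀ {d} → Vec ℤ d → ℕ → ℤ
  vecToSeries []       n       = ℤ.0ℤ
  vecToSeries (b ∷ bs) zero    = b
  vecToSeries (b ∷ bs) (suc n) = vecToSeries bs n

  prefix : ∀ d → (ℕ → ℤ) → Vec ℤ d
  prefix zero    f = []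
  prefix (suc d) f = f 0 ∷ prefix d (tail f)

  -- The relation is a parameter because series are recognised as polynomials both over ℤ and modulo
  -- p.
  prefix-complete : ∀ {ℓ} {_~_ : ℤ → ℤ → Set ℓ} → (∀ {x} → x ~ x) → ∀ d f →
    (∀ n → d ≤ n → f n ~ ℤ.0ℤ) → ∀ n → f n ~ vecToSeries (prefix d f) n
  prefix-complete {_~_ = _~_} ~-refl zero    f len n       = len n z≤n
  prefix-complete {_~_ = _~_} ~-refl (suc d) f len zero    = ~-refl
  prefix-complete {_~_ = _~_} ~-refl (suc d) f len (suc n) =
    prefix-complete {_~_ = _~_} ~-refl d (tail f) (λ n d≤n → len (suc n) (s≤s d≤n)) n

  -- The values of ψ that meet b₀, b₁, ... in the coefficient of b·ψ at `d ℕ.+ n`, hence in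
  -- descending order. Up to reversal these are rows of a Hankel matrix, whose kernel detects
  -- rationality as in Kronecker's criterion.
  window : ∀ d → (ℕ → ℤ) → ℕ → Vec ℤ d
  window zero    ψ n = []
  window (suc d) ψ n = ψ (suc d ℕ.+ n) ∷ window d ψ n

  mul-window : ∀ {d} (b : Vec ℤ d) ψ n → mul (vecToSeries b) ψ (d ℕ.+ n) ≡ dot b (window d ψ n)
  mul-window []                 ψ n = ℤ-Series.mul-zeroˡ ψ n
  mul-window {suc d} (b ∷ bs) ψ n =
    ≡.cong₂ ℤ._+_ {b ℤ.* ψ (suc d ℕ.+ n)} refl (mul-window bs ψ n)

  -- Irrationality of ψ, for denominators b and numerators of length at most d.
  Irrational : ℕ → (ℕ → ℤ) → Set
  Irrational d ψ = ∀ (b : Vec ℤ d) → VecAny.Any (_≢ ℤ.0ℤ) b → ¬ (∀ n → mul (vecToSeries b) ψ (d ℕ.+ n) ≡ ℤ.0ℤ)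

  Eventually : (ℕ → Set) → Set
  Eventually P = ∃ λ n₀ → ∀ n → n₀ < n → P n

  -- Double negation commutes with finite conjunctions, and only finitely many pairs of monomials
  -- need a threshold.
  eventually-∀ : ∀ {N} {P : Fin N → ℕ → Set} → (∀ i → ¬ ¬ Eventually (P i)) →
    ¬ ¬ Eventually (λ n → ∀ i → P i n)
  eventually-∀ {zero}  ev k = k (0 , λ _ _ ())
  eventually-∀ {suc N} ev k = ev zero λ (n₀ , first) → eventually-∀ (ev ∘ suc) λ (n₁ , rest) →
    k (n₀ ℕ.⊔ n₁ , λ where
      n n₀⊔n₁<n zero    → first n (ℕ.m⊔n<o⇒m<o n₀ n₁ n₀⊔n₁<n)
      n n₀⊔n₁<n (suc i) → rest n (ℕ.m⊔n<o⇒n<o n₀ n₁ n₀⊔n₁<n) i)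

  -- The vectors `window d ψ n` are the same for all primes, so the threshold depends on `d` and `ψ`
  -- only.
  irrational-mod-large-primes : ∀ d ψ → Irrational d ψ →
    ¬ ¬ Eventually λ q → (p-prime : Prime (suc q)) → let open ModuloPrime q p-prime using (Length; module S) in
      ∀ b → Length d b → Length d (mul b ψ) → b S.≈ S.0#
  irrational-mod-large-primes d ψ irrational k =
    trivial-kernel-mod-large-primes d (window d ψ)
      (λ b b≢0 kills → irrational b b≢0 λ n → ≡.trans (mul-window b ψ n) (kills n))
      λ (n₀ , large) → k (n₀ , λ q n₀<q p-prime b len len-bψ →
        let open ModuloPrime q p-prime using (ring; ≡⇒≈; ≈0⇒∣; module S)
            b≈prefix : b S.≈ vecToSeries (prefix d b)
            b≈prefix = prefix-complete {_~_ = Modulo._≈_ (suc q)} (≡⇒≈ refl) d b len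
        in S.trans b≈prefix (All⇒≈0 q (large (suc q) p-prime (ℕ.m<n⇒m<1+n n₀<q) (prefix d b) λ n →
          ≡.subst (+ suc q ∣_) (mul-window (prefix d b) ψ n)
            (≈0⇒∣ (CommutativeRing.trans ring
              (S.*-congʳ {ψ} (S.sym b≈prefix) (d ℕ.+ n)) (len-bψ (d ℕ.+ n) (ℕ.m≤m+n d n)))))))
    where
    All⇒≈0 : ∀ q {d} {b : Vec ℤ d} → let open Modulo (suc q) in
      VecAll.All (+ suc q ∣_) b → ∀ n → vecToSeries b n ≈ ℤ.0ℤ
    All⇒≈0 q []         n       = Modulo.≡⇒≈ (suc q) refl
    All⇒≈0 q (p∣b ∷ ps) zero    = Modulo.∣⇒≈0 (suc q) p∣b
    All⇒≈0 q (p∣b ∷ ps) (suc n) = All⇒≈0 q ps n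

  truncate : ℕ → (ℕ → ℤ) → ℕ → ℤ
  truncate d f n with n ℕ.<? d
  ... | yes _ = f n
  ... | no  _ = ℤ.0ℤ

  truncate-< : ∀ {d n} f → n < d → truncate d f n ≡ f n
  truncate-< {d} {n} f n<d with n ℕ.<? d
  ... | yes _   = refl
  ... | no  n≮d = contradiction n<d n≮d

  truncate-≥ : ∀ {d n} f → d ≤ n → truncate d f n ≡ ℤ.0ℤ
  truncate-≥ {d} {n} f d≤n with n ℕ.<? d
  ... | yes n<d = contradiction n<d (ℕ.≤⇒≯ d≤n)
  ... | no  _   = refl

  -- The Lucas property says that the section `Λ r a` is a(r)·a modulo p. The truncation of a at p
  -- has the constants a(r) as sections, so it is the required factor.
  lucas-Frobenius : ∀ {a a⁻¹} → LucasProperty a → (∀ n → mul a a⁻¹ n ≡ one n) →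
    ∀ q (p-prime : Prime (suc q)) → ModuloPrime.Frobenius q p-prime 1 a
  lucas-Frobenius {a} {a⁻¹} lucas inv q p-prime = record
    { inverse   = a⁻¹
    ; isInverse = λ n → ≡⇒≈ (inv n)
    ; factor    = truncate p a
    ; frobenius = Λ-ext λ r r<p → S.begin
        Λ r a                              S.≈⟨ (λ n → R.trans (lucas-≈ n r r<p) (R.*-comm (a n) (a r))) ⟩
        (λ n → a r ℤ.* a n)                S.≈⟨ (λ n → R.*-congˡ {a r} (S.*-identityˡ a n)) ⟨
        (λ n → a r ℤ.* mul one a n)        S.≈⟨ mul-scaleˡ (a r) one a ⟨
        mul (λ n → a r ℤ.* one n) a        S.≈⟨ S.*-congʳ {a} (λ n → ≡⇒≈ (Λ-truncate r r<p n)) ⟨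
        mul (Λ r (truncate p a)) a         S.≈⟨ S.*-comm (Λ r (truncate p a)) a ⟩
        mul a (Λ r (truncate p a))         S.≈⟨ Λ-mul r r<p a (truncate p a) ⟨
        Λ r (mul (σ a) (truncate p a))     S.≈⟨ (λ n → S.*-comm (σ a) (truncate p a) (n ℕ.* p ℕ.+ r)) ⟩
        Λ r (mul (truncate p a) (σ a))     S.∎
    ; length    = λ n p≤n → ≡⇒≈ (truncate-≥ a (≡.subst (_≤ n) (ℕ.+-identityʳ p) p≤n))
    }
    where
    open ModuloPrime q p-prime hiding (mul; one; ∂; sum; monomial; exponents·_)
    module R = CommutativeRing ring

    lucas-≈ : ∀ n r → r < p → a (n ℕ.* p ℕ.+ r) R.≈ a n ℤ.* a r
    lucas-≈ n r r<p = Modulo.mod (≡.subst (λ m → + p ∣ a m ℤ.- a n ℤ.* a r)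
      (≡.cong (ℕ._+ r) (ℕ.*-comm p n)) (∣ᵤ⇒∣ (lucas p p-prime n r r<p)))

    Λ-truncate : ∀ r → r < p → ∀ n → Λ r (truncate p a) n ≡ a r ℤ.* one n
    Λ-truncate r r<p zero    = ≡.trans (truncate-< a r<p) (≡.sym (ℤ.*-identityʳ (a r)))
    Λ-truncate r r<p (suc n) = ≡.trans
      (truncate-≥ a (ℕ.≤-trans (ℕ.m≤m+n p (n ℕ.* p)) (ℕ.m≤m+n _ r))) (≡.sym (ℤ.*-zeroʳ (a r)))

  lookup-≢ : ∀ {s} {u v : Vec ℕ s} → u ≢ v → ∃ λ i → lookup u i ≢ lookup v i
  lookup-≢ {u = []}    {[]}    u≢v = contradiction refl u≢v
  lookup-≢ {u = x ∷ u} {y ∷ v} u≢v with x ℕ.≟ y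
  ... | no x≢y   = zero , x≢y
  ... | yes refl with lookup-≢ (u≢v ∘ ≡.cong (x ∷_))
  ...   | i , uᵢ≢vᵢ = suc i , uᵢ≢vᵢ

  exponents-- : ∀ {s} (u v : Vec ℕ s) φ n →
    (exponents· u) φ n ℤ.- (exponents· v) φ n ≡
    sum (λ i n → (+ lookup u i ℤ.- + lookup v i) ℤ.* φ i n) n
  exponents-- []      []      φ n = refl
  exponents-- (x ∷ u) (y ∷ v) φ n = ≡.trans
    (regroup (+ x) (+ y) (φ zero n) ((exponents· u) (φ ∘ suc) n) ((exponents· v) (φ ∘ suc) n))
    (≡.cong₂ ℤ._+_ {(+ x ℤ.- + y) ℤ.* φ zero n} refl (exponents-- u v (φ ∘ suc) n))
    where
    regroup : ∀ x y a X Y → (x ℤ.* a ℤ.+ X) ℤ.- (y ℤ.* a ℤ.+ Y) ≡ (x ℤ.- y) ℤ.* a ℤ.+ (X ℤ.- Y)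
    regroup = solve-∀

  -- Relations between monomials over ℤ

  module _ {s : ℕ} (f f⁻¹ : Fin s → ℕ → ℤ) (inv : ∀ i n → mul (f i) (f⁻¹ i) n ≡ one n)
    (lucas : ∀ i → LucasProperty (f i)) where

    private
      φ : Fin s → ℕ → ℤ
      φ i = mul (∂ (f i)) (f⁻¹ i)

    ∂-log : ∀ i n → ∂ (f i) n ≡ mul (φ i) (f i) n
    ∂-log i = S.begin
      ∂ (f i)                               S.≈⟨ S.*-identityʳ (∂ (f i)) ⟨
      mul (∂ (f i)) one                     S.≈⟨ S.*-congˡ {∂ (f i)} (inv i) ⟨
      mul (∂ (f i)) (mul (f i) (f⁻¹ i))     S.≈⟨ S.solve 3 (λ d f f′ → d S.:* (f S.:* f′) S.:= (d S.:* f′) S.:* f)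
                                                 S.refl (∂ (f i)) (f i) (f⁻¹ i) ⟩
      mul (φ i) (f i)                       S.∎
      where
      open ℤ-Series

    -- One prime suffices, if it exceeds the thresholds of all pairs of monomials, the requirement
    -- of the descent and |c k n|. Then c k n is nonzero modulo p, whereas `independent` makes it
    -- vanish.
    monomials-independent :
      (∀ (m : Fin s → ℤ) → (∃ λ i → m i ≢ ℤ.0ℤ) → ∀ d → Irrational d (sum λ i n → m i ℤ.* φ i n)) →
      ∀ {N} (v : Fin N → Vec ℕ s) → (∀ {k l} → k ≢ l → v k ≢ v l) →
      ∀ (c : Fin N → ℕ → ℤ) L → (∀ k n → L ≤ n → c k n ≡ ℤ.0ℤ) →
      (∀ n → sum (λ k → mul (c k) (monomial f (v k))) n ≡ ℤ.0ℤ) →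
      ¬ ∃ λ k → ∃ λ n → c k n ≢ ℤ.0ℤ
    monomials-independent irrational {N} v v-injective c L len rel (k , n , cₖₙ≢0) =
      eventually-∀ (λ k → eventually-∀ (nondegenerate k)) λ (n₀ , large) →
        contradict (n₀ ℕ.⊔ (ℤ.∣ c k n ∣ ℕ.⊔ suc M))
          (λ q b<q k l → large q (ℕ.m⊔n<o⇒m<o n₀ _ b<q) k l)
          (λ q b<q → ℕ.m⊔n<o⇒m<o ℤ.∣ c k n ∣ (suc M) (ℕ.m⊔n<o⇒n<o n₀ _ b<q))
          (λ q b<q → ℕ.m⊔n<o⇒n<o ℤ.∣ c k n ∣ (suc M) (ℕ.m⊔n<o⇒n<o n₀ _ b<q))
      where
      M : ℕ
      M = proj₁ (upper-bound (weight ∘ v))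

      g : Fin N → ℕ → ℤ
      g k = monomial f (v k)

      Nondegenerate : Fin N → Fin N → ℕ → Set
      Nondegenerate k l q = (p-prime : Prime (suc q)) → k ≢ l →
        let open ModuloPrime q p-prime using (Length; wronskian; module S) in
        ∀ u v → Length (suc M) u → Length (suc M) v →
          wronskian (mul u (g k)) (mul v (g l)) → mul u v S.≈ S.0#

      ∂-g : ∀ k n → ∂ (g k) n ≡ mul ((exponents· v k) φ) (g k) n
      ∂-g k = ℤ-Series.∂-monomial-log ∂-log (v k)

      g-Frobenius : ∀ q p-prime k → ModuloPrime.Frobenius q p-prime M (g k)
      g-Frobenius q p-prime k = ModuloPrime.Frobenius-≤ q p-prime (proj₂ (upper-bound (weight ∘ v)) k)
        (ModuloPrime.Frobenius-monomial q p-prime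
          (λ i → lucas-Frobenius (lucas i) (inv i) q p-prime) (v k))

      nondegenerate : ∀ k l → ¬ ¬ Eventually (Nondegenerate k l)
      nondegenerate k l with k Fin.≟ l
      ... | yes k≡l = λ ¬ev → ¬ev (0 , λ q _ p-prime k≢l → contradiction k≡l k≢l)
      -- Modulo p, x·y is a denominator of ψ. As x and y have length M + 1, denominator and
      -- numerator have length at most 2(M + 1) for every p, so a single instance of irrationality
      -- covers all primes.
      ... | no  k≢l = λ ¬ev → irrational-mod-large-primes (suc M ℕ.+ suc M) ψ ψ-irrational
        λ (n₀ , large) → ¬ev (n₀ , λ q n₀<q p-prime _ x y len-x len-y wr →
          let open ModuloPrime q p-prime using (≡⇒≈; Length-mul; log-difference-rational; module Frobenius)
              module G k = Frobenius (g-Frobenius q p-prime k)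
          in large q n₀<q p-prime (mul x y) (Length-mul len-x len-y)
            (log-difference-rational (G.isInverse k) (G.isInverse l)
              (λ n → ≡⇒≈ (∂-g k n)) (λ n → ≡⇒≈ (∂-g l n)) x y len-x len-y wr))
        where
        ψ : ℕ → ℤ
        ψ n = (exponents· v l) φ n ℤ.- (exponents· v k) φ n

        m : Fin s → ℤ
        m i = + lookup (v l) i ℤ.- + lookup (v k) i

        m≢0 : ∃ λ i → m i ≢ ℤ.0ℤ
        m≢0 with lookup-≢ (v-injective (k≢l ∘ ≡.sym))
        ... | i , vₗᵢ≢vₖᵢ = i , λ mᵢ≡0 → vₗᵢ≢vₖᵢ (ℤ.+-injective (ℤ.i-j≡0⇒i≡j _ _ mᵢ≡0))

        ψ-irrational : Irrational (suc M ℕ.+ suc M) ψ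
        ψ-irrational b b≢0 rational = irrational m m≢0 (suc M ℕ.+ suc M) b b≢0 λ n → ≡.trans
          (ℤ-Series.S.*-congˡ {vecToSeries b} (λ i → ≡.sym (exponents-- (v l) (v k) φ i)) (suc M ℕ.+ suc M ℕ.+ n))
          (rational n)

      contradict : ∀ n₀ →
        (∀ q → n₀ < q → ∀ k l → Nondegenerate k l q) →
        (∀ q → n₀ < q → ℤ.∣ c k n ∣ < q) → (∀ q → n₀ < q → suc M < q) → ⊥
      -- The thresholds concern q, where p = `suc q`; hence `suc n₀`.
      contradict n₀ large c-small M-small with prime-above (suc n₀)
      ... | suc q , p-prime , n₀<p = small-not-divisible cₖₙ≢0 (ℕ.m<n⇒m<1+n (c-small q (s≤s⁻¹ n₀<p)))
        -- Coefficients of length L have length M + 1 + L, so the descent starts at t = L.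
        (≈0⇒∣ (independent M (ℕ.m≤n⇒m≤1+n (M-small q (s≤s⁻¹ n₀<p))) N L g (g-Frobenius q p-prime)
          (λ k l → large q (s≤s⁻¹ n₀<p) k l p-prime) c
          (λ k n L≤n → ≡⇒≈ (len k n (ℕ.≤-trans (ℕ.m≤n+m L (suc M)) L≤n))) (λ n → ≡⇒≈ (rel n)) k n))
        where
        open ModuloPrime q p-prime using (≡⇒≈; ≈0⇒∣; independent)

-- From ℚ to ℤ

ℤtoℚᵘ : ∀ x → toℚᵘ (ℤtoℚ x) ≃ mkℚᵘ x 0
ℤtoℚᵘ x = ℚ.toℚᵘ-fromℚᵘ (mkℚᵘ x 0)

ℤtoℚ-injective : ∀ {x y} → ℤtoℚ x ≡ ℤtoℚ y → x ≡ y
ℤtoℚ-injective {x} {y} eq with ℚ.fromℚᵘ-injective {mkℚᵘ x 0} {mkℚᵘ y 0} eq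
... | *≡* x*1≡y*1 = ≡.trans (≡.sym (ℤ.*-identityʳ x)) (≡.trans x*1≡y*1 (ℤ.*-identityʳ y))

ℤtoℚ-+ : ∀ x y → ℤtoℚ (x ℤ.+ y) ≡ ℤtoℚ x ℚ.+ ℤtoℚ y
ℤtoℚ-+ x y = ℚ.toℚᵘ-injective (begin
  toℚᵘ (ℤtoℚ (x ℤ.+ y))              ≈⟨ ℤtoℚᵘ (x ℤ.+ y) ⟩
  mkℚᵘ (x ℤ.+ y) 0                   ≈⟨ *≡* (identity x y) ⟩
  mkℚᵘ x 0 ℚᵘ.+ mkℚᵘ y 0             ≈⟨ ℚᵘ.+-cong (ℤtoℚᵘ x) (ℤtoℚᵘ y) ⟨
  toℚᵘ (ℤtoℚ x) ℚᵘ.+ toℚᵘ (ℤtoℚ y)   ≈⟨ ℚ.toℚᵘ-homo-+ (ℤtoℚ x) (ℤtoℚ y) ⟨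
  toℚᵘ (ℤtoℚ x ℚ.+ ℤtoℚ y)           ∎)
  where
  open import Relation.Binary.Reasoning.Setoid ℚᵘ.≃-setoid
  identity : ∀ x y → (x ℤ.+ y) ℤ.* ℤ.1ℤ ≡ (x ℤ.* ℤ.1ℤ ℤ.+ y ℤ.* ℤ.1ℤ) ℤ.* ℤ.1ℤ
  identity = solve-∀

ℤtoℚ-* : ∀ x y → ℤtoℚ (x ℤ.* y) ≡ ℤtoℚ x ℚ.* ℤtoℚ y
ℤtoℚ-* x y = ℚ.toℚᵘ-injective (begin
  toℚᵘ (ℤtoℚ (x ℤ.* y))              ≈⟨ ℤtoℚᵘ (x ℤ.* y) ⟩
  mkℚᵘ x 0 ℚᵘ.* mkℚᵘ y 0             ≈⟨ ℚᵘ.*-cong (ℤtoℚᵘ x) (ℤtoℚᵘ y) ⟨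
  toℚᵘ (ℤtoℚ x) ℚᵘ.* toℚᵘ (ℤtoℚ y)   ≈⟨ ℚ.toℚᵘ-homo-* (ℤtoℚ x) (ℤtoℚ y) ⟨
  toℚᵘ (ℤtoℚ x ℚ.* ℤtoℚ y)           ∎)
  where
  open import Relation.Binary.Reasoning.Setoid ℚᵘ.≃-setoid

ℤtoℚ-neg : ∀ x → ℤtoℚ (ℤ.- x) ≡ ℚ.- ℤtoℚ x
ℤtoℚ-neg x = ℚ.toℚᵘ-injective (begin
  toℚᵘ (ℤtoℚ (ℤ.- x))    ≈⟨ ℤtoℚᵘ (ℤ.- x) ⟩
  ℚᵘ.- mkℚᵘ x 0          ≈⟨ ℚᵘ.-‿cong (ℤtoℚᵘ x) ⟨
  ℚᵘ.- toℚᵘ (ℤtoℚ x)     ≈⟨ ℚ.toℚᵘ-homo‿- (ℤtoℚ x) ⟨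
  toℚᵘ (ℚ.- ℤtoℚ x)      ∎)
  where
  open import Relation.Binary.Reasoning.Setoid ℚᵘ.≃-setoid

↧*-≡-↥ : ∀ q → ℤtoℚ (↧ q) ℚ.* q ≡ ℤtoℚ (↥ q)
↧*-≡-↥ q@record{} = ℚ.toℚᵘ-injective (begin
  toℚᵘ (ℤtoℚ (↧ q) ℚ.* q)            ≈⟨ ℚ.toℚᵘ-homo-* (ℤtoℚ (↧ q)) q ⟩
  toℚᵘ (ℤtoℚ (↧ q)) ℚᵘ.* toℚᵘ q      ≈⟨ ℚᵘ.*-congʳ {toℚᵘ q} (ℤtoℚᵘ (↧ q)) ⟩
  mkℚᵘ (↧ q) 0 ℚᵘ.* toℚᵘ q           ≈⟨ *≡* (≡.trans (identity (↧ q) (↥ q))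
                                          (≡.cong (λ d → ↥ q ℤ.* d) (≡.sym (ℤ.*-identityˡ (↧ q))))) ⟩
  mkℚᵘ (↥ q) 0                       ≈⟨ ℤtoℚᵘ (↥ q) ⟨
  toℚᵘ (ℤtoℚ (↥ q))                  ∎)
  where
  open import Relation.Binary.Reasoning.Setoid ℚᵘ.≃-setoid
  identity : ∀ d n → (d ℤ.* n) ℤ.* ℤ.1ℤ ≡ n ℤ.* d
  identity = solve-∀

-- Agreement of the series operations over ℚ and ℤ

module ℚ-Series = PowerSeries ℚ.+-*-commutativeRing ℕtoℚ refl (λ n → ℤtoℚ-+ ℤ.1ℤ (+ n))

*ₛ-mul : ∀ f g → (f *ₛ g) ≈ₛ ℚ-Series.mul f g
*ₛ-mul f g = convAux-mul f 0 (λ _ → refl)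
  where
  -- `convAux` advances an index where `mul` takes tails; `h` stands for `f` shifted by `k`.
  convAux-mul : ∀ h k → (∀ i → f (k ℕ.+ i) ≡ h i) → ∀ n → convAux f g k n ≡ ℚ-Series.mul h g n
  convAux-mul h k eq zero    = ≡.cong (ℚ._* g 0) (≡.trans (≡.cong f (≡.sym (ℕ.+-identityʳ k))) (eq 0))
  convAux-mul h k eq (suc n) = ≡.cong₂ ℚ._+_
    (≡.cong (ℚ._* g (suc n)) (≡.trans (≡.cong f (≡.sym (ℕ.+-identityʳ k))) (eq 0)))
    (convAux-mul (tail h) (suc k) (λ i → ≡.trans (≡.cong f (≡.sym (ℕ.+-suc k i))) (eq (suc i))) n)

mul-toSeries : ∀ f g n → ℚ-Series.mul (toSeries f) (toSeries g) n ≡ ℤtoℚ (ℤ-Series.mul f g n)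
mul-toSeries f g zero    = ≡.sym (ℤtoℚ-* (f 0) (g 0))
mul-toSeries f g (suc n) = ≡.trans
  (≡.cong₂ ℚ._+_ (≡.sym (ℤtoℚ-* (f 0) (g (suc n)))) (mul-toSeries (tail f) g n))
  (≡.sym (ℤtoℚ-+ (f 0 ℤ.* g (suc n)) (ℤ-Series.mul (tail f) g n)))

one-toSeries : ∀ n → ℚ-Series.one n ≡ ℤtoℚ (ℤ-Series.one n)
one-toSeries zero    = refl
one-toSeries (suc n) = refl

sum-toSeries : ∀ {N} (h : Fin N → ℕ → ℤ) n →
  ℚ-Series.sum (toSeries ∘ h) n ≡ ℤtoℚ (ℤ-Series.sum h n)
sum-toSeries {zero}  h n = refl
sum-toSeries {suc N} h n = ≡.trans (≡.cong (ℤtoℚ (h zero n) ℚ.+_) (sum-toSeries (h ∘ suc) n))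
  (≡.sym (ℤtoℚ-+ (h zero n) (ℤ-Series.sum (h ∘ suc) n)))

∂-toSeries : ∀ f n → deriv (toSeries f) n ≡ ℤtoℚ (ℤ-Series.∂ f n)
∂-toSeries f n = ≡.sym (ℤtoℚ-* (+ suc n) (f (suc n)))

pow-toSeries : ∀ f e n → ℚ-Series.pow (toSeries f) e n ≡ ℤtoℚ (ℤ-Series.pow f e n)
pow-toSeries f zero    = one-toSeries
pow-toSeries f (suc e) n = ≡.trans (ℚ-Series.S.*-congˡ {toSeries f} (pow-toSeries f e) n)
  (mul-toSeries f (ℤ-Series.pow f e) n)

monomial-toSeries : ∀ {s} (f : Fin s → ℕ → ℤ) v n →
  ℚ-Series.monomial (toSeries ∘ f) v n ≡ ℤtoℚ (ℤ-Series.monomial f v n)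
monomial-toSeries f []      = one-toSeries
monomial-toSeries f (e ∷ v) n = ≡.trans
  (ℚ-Series.S.*-cong (pow-toSeries (f zero) e) (monomial-toSeries (f ∘ suc) v) n)
  (mul-toSeries (ℤ-Series.pow (f zero) e) (ℤ-Series.monomial (f ∘ suc) v) n)

-- `invList` holds the inverse from its latest coefficient down, the order in which the convolution
-- meets them.
invSum-convAux : ∀ f i n → invSum f i (invList f n) ≡ convAux f (inv₁ f) (suc i) n
invSum-convAux f i zero    = ℚ.+-identityʳ _
invSum-convAux f i (suc n) = ≡.cong (f (suc i) ℚ.* inv₁ f (suc n) ℚ.+_) (invSum-convAux f (suc i) n)

*ₛ-inv₁ : ∀ f → f 0 ≡ 1ℚ → (f *ₛ inv₁ f) ≈ₛ ℚ-Series.one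
*ₛ-inv₁ f f₀≡1 zero    = ≡.trans (ℚ.*-identityʳ (f 0)) f₀≡1
*ₛ-inv₁ f f₀≡1 (suc n) = ≡.trans
  (≡.cong₂ ℚ._+_ (≡.trans (≡.cong (ℚ._* inv₁ f (suc n)) f₀≡1) (ℚ.*-identityˡ (inv₁ f (suc n))))
                 (≡.sym (invSum-convAux f 0 n)))
  (ℚ.+-inverseˡ (invSum f 0 (invList f n)))

IsIntegral : ℚ → Set
IsIntegral q = ∃ λ z → q ≡ ℤtoℚ z

-- The recursion for constant term 1 never divides. Hence the logarithmic derivatives are integer
-- series and can be reduced modulo p.
inv₁-integral : ∀ a n → IsIntegral (inv₁ (toSeries a) n)
inv₁-integral a n = head-integral (invList-integral n)
  where
  head-integral : ∀ {qs} → All IsIntegral qs → IsIntegral (headOr0 qs)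
  head-integral []       = ℤ.0ℤ , refl
  head-integral (q ∷ qs) = q

  invSum-integral : ∀ i {qs} → All IsIntegral qs → IsIntegral (invSum (toSeries a) i qs)
  invSum-integral i []               = ℤ.0ℤ , refl
  invSum-integral i ((z , refl) ∷ qs) with invSum-integral (suc i) qs
  ... | w , eq = a (suc i) ℤ.* z ℤ.+ w , ≡.trans
    (≡.cong₂ ℚ._+_ (≡.sym (ℤtoℚ-* (a (suc i)) z)) eq) (≡.sym (ℤtoℚ-+ (a (suc i) ℤ.* z) w))

  invList-integral : ∀ n → All IsIntegral (invList (toSeries a) n)
  invList-integral zero    = (ℤ.1ℤ , refl) ∷ []
  invList-integral (suc n) with invSum-integral 0 (invList-integral n)
  ... | w , eq = (ℤ.- w , ≡.trans (≡.cong ℚ.-_ eq) (≡.sym (ℤtoℚ-neg w))) ∷ invList-integral n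

inverse : (ℕ → ℤ) → ℕ → ℤ
inverse a n = proj₁ (inv₁-integral a n)

inv₁-inverse : ∀ a → inv₁ (toSeries a) ≈ₛ toSeries (inverse a)
inv₁-inverse a n = proj₂ (inv₁-integral a n)

mul-inverseʳ : ∀ a → a 0 ≡ + 1 → ∀ n → ℤ-Series.mul a (inverse a) n ≡ ℤ-Series.one n
mul-inverseʳ a a₀≡1 n = ℤtoℚ-injective (begin
  ℤtoℚ (ℤ-Series.mul a (inverse a) n)                    ≡⟨ mul-toSeries a (inverse a) n ⟨
  ℚ-Series.mul (toSeries a) (toSeries (inverse a)) n     ≡⟨ ℚ-Series.S.*-congˡ {toSeries a} (inv₁-inverse a) n ⟨
  ℚ-Series.mul (toSeries a) (inv₁ (toSeries a)) n        ≡⟨ *ₛ-mul (toSeries a) (inv₁ (toSeries a)) n ⟨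
  (toSeries a *ₛ inv₁ (toSeries a)) n                    ≡⟨ *ₛ-inv₁ (toSeries a) (≡.cong ℤtoℚ a₀≡1) n ⟩
  ℚ-Series.one n                                         ≡⟨ one-toSeries n ⟩
  ℤtoℚ (ℤ-Series.one n)                                  ∎)
  where open ≡.≡-Reasoning

logDeriv-toSeries : ∀ a n →
  logDeriv (toSeries a) n ≡ ℤtoℚ (ℤ-Series.mul (ℤ-Series.∂ a) (inverse a) n)
logDeriv-toSeries a n = begin
  (deriv (toSeries a) *ₛ inv₁ (toSeries a)) n
    ≡⟨ *ₛ-mul (deriv (toSeries a)) (inv₁ (toSeries a)) n ⟩
  ℚ-Series.mul (deriv (toSeries a)) (inv₁ (toSeries a)) n
    ≡⟨ ℚ-Series.S.*-cong (∂-toSeries a) (inv₁-inverse a) n ⟩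
  ℚ-Series.mul (toSeries (ℤ-Series.∂ a)) (toSeries (inverse a)) n
    ≡⟨ mul-toSeries (ℤ-Series.∂ a) (inverse a) n ⟩
  ℤtoℚ (ℤ-Series.mul (ℤ-Series.∂ a) (inverse a) n) ∎
  where open ≡.≡-Reasoning

-- Polynomials as lists of monomials with coefficients

Term : ℕ → Set
Term s = Vec ℕ s × Polyℚ

raise : ∀ {s} → Term (suc s) → Term (suc s)
raise (e ∷ v , P) = suc e ∷ v , P

pad : ∀ {s} → Term s → Term (suc s)
pad (v , P) = 0 ∷ v , P

terms : ∀ s → MPoly s → List (Term s)
terms zero    P        = ([] , P) ∷ []
terms (suc s) []       = []
terms (suc s) (P ∷ Ps) = List.map pad (terms s P) List.++ List.map raise (terms (suc s) Ps)

module _ where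
  open ℚ-Series
  open S using (solve; _:=_; _:+_; _:*_)

  evalTerms : ∀ {s} → List (Term s) → (Fin s → Series) → Series
  evalTerms ts f = sum λ k → let (v , P) = List.lookup ts k in mul (polyToSeries P) (monomial f v)

  evalTerms-++ : ∀ {s} (ts us : List (Term s)) f →
    evalTerms (ts List.++ us) f S.≈ (evalTerms ts f S.+ evalTerms us f)
  evalTerms-++ []             us f = S.sym (S.+-identityˡ (evalTerms us f))
  evalTerms-++ ((v , P) ∷ ts) us f = S.trans
    (S.+-congˡ {mul (polyToSeries P) (monomial f v)} (evalTerms-++ ts us f))
    (S.sym (S.+-assoc (mul (polyToSeries P) (monomial f v)) (evalTerms ts f) (evalTerms us f)))

  evalTerms-pad : ∀ {s} (ts : List (Term s)) f →
    evalTerms (List.map pad ts) f S.≈ evalTerms ts (f ∘ suc)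
  evalTerms-pad []             f = S.refl
  evalTerms-pad ((v , P) ∷ ts) f = S.+-cong
    (S.*-congˡ {polyToSeries P} (S.*-identityˡ (monomial (f ∘ suc) v))) (evalTerms-pad ts f)

  evalTerms-raise : ∀ {s} (ts : List (Term (suc s))) f →
    evalTerms (List.map raise ts) f S.≈ mul (f zero) (evalTerms ts f)
  evalTerms-raise []                 f = S.sym (S.zeroʳ (f zero))
  evalTerms-raise ((e ∷ v , P) ∷ ts) f = S.trans
    (S.+-cong (solve 4 (λ c x y m → c :* ((x :* y) :* m) := x :* (c :* (y :* m)))
                 S.refl (polyToSeries P) (f zero) (pow (f zero) e) (monomial (f ∘ suc) v))
              (evalTerms-raise ts f))
    (S.sym (S.distribˡ (f zero) (mul (polyToSeries P) (monomial f (e ∷ v))) (evalTerms ts f)))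

  evalMPoly-terms : ∀ s P f → evalMPoly s P f S.≈ evalTerms (terms s P) f
  evalMPoly-terms zero    P        f = S.sym (S.trans
    (S.+-identityʳ (mul (polyToSeries P) one)) (S.*-identityʳ (polyToSeries P)))
  evalMPoly-terms (suc s) []       f = S.refl
  evalMPoly-terms (suc s) (P ∷ Ps) f = S.trans
    (S.+-cong
      (S.trans (evalMPoly-terms s P (f ∘ suc)) (S.sym (evalTerms-pad (terms s P) f)))
      (S.trans (*ₛ-mul (f zero) (evalMPoly (suc s) Ps f))
        (S.trans (S.*-congˡ {f zero} (evalMPoly-terms (suc s) Ps f))
          (S.sym (evalTerms-raise (terms (suc s) Ps) f)))))
    (S.sym (evalTerms-++ (List.map pad (terms s P)) (List.map raise (terms (suc s) Ps)) f))

Distinct : ∀ {s} → Term s → Term s → Set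
Distinct t u = proj₁ t ≢ proj₁ u

-- Padded terms have first exponent 0 and raised ones a positive first exponent, so the two groups
-- never meet.
terms-distinct : ∀ s P → AllPairs Distinct (terms s P)
terms-distinct zero    P        = [] ∷ []
terms-distinct (suc s) []       = []
terms-distinct (suc s) (P ∷ Ps) = AllPairs.++⁺
  (AllPairs.map⁺ (AllPairs.map (λ u≢v → u≢v ∘ ≡.cong Vec.tail) (terms-distinct s P)))
  (AllPairs.map⁺ (AllPairs.map (λ { {_ ∷ _ , _} {_ ∷ _ , _} u≢v refl → u≢v refl }) (terms-distinct (suc s) Ps)))
  (All.map⁺ (All.universal (λ t → All.map⁺ (All.universal
    (λ { (e ∷ v , Q) → λ () }) (terms (suc s) Ps))) (terms s P)))

terms-nonzero : ∀ s P → NonzeroMPoly s P → Any (NonzeroPoly ∘ proj₂) (terms s P)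
terms-nonzero zero    P        P≢0       = here P≢0
terms-nonzero (suc s) (P ∷ Ps) (here P≢0)   = Any.++⁺ˡ (Any.map⁺ (terms-nonzero s P P≢0))
terms-nonzero (suc s) (P ∷ Ps) (there Ps≢0) = Any.++⁺ʳ (List.map pad (terms s P))
  (Any.map⁺ (Any.map (λ { {_ ∷ _ , _} Q≢0 → Q≢0 }) (terms-nonzero (suc s) Ps Ps≢0)))

lookup-distinct : ∀ {s} {ts : List (Term s)} → AllPairs Distinct ts →
  ∀ {k l} → k ≢ l → Distinct (List.lookup ts k) (List.lookup ts l)
lookup-distinct (px ∷ pxs) {zero}  {zero}  k≢l = contradiction refl k≢l
lookup-distinct (px ∷ pxs) {zero}  {suc l} k≢l = All.lookup px (∈-lookup l)
lookup-distinct (px ∷ pxs) {suc k} {zero}  k≢l = All.lookup px (∈-lookup k) ∘ ≡.sym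
lookup-distinct (px ∷ pxs) {suc k} {suc l} k≢l = lookup-distinct pxs (k≢l ∘ ≡.cong suc)

-- Clearing denominators

Clears : ℤ → Series → Set
Clears d f = ∀ n → IsIntegral (ℤtoℚ d ℚ.* f n)

clears-* : ∀ d e {f} → Clears d f → Clears (e ℤ.* d) f
clears-* d e {f} clears n with clears n
... | z , df≡z = e ℤ.* z , (begin
  ℤtoℚ (e ℤ.* d) ℚ.* f n          ≡⟨ ≡.cong (ℚ._* f n) (ℤtoℚ-* e d) ⟩
  ℤtoℚ e ℚ.* ℤtoℚ d ℚ.* f n       ≡⟨ ℚ.*-assoc (ℤtoℚ e) (ℤtoℚ d) (f n) ⟩
  ℤtoℚ e ℚ.* (ℤtoℚ d ℚ.* f n)     ≡⟨ ≡.cong (ℤtoℚ e ℚ.*_) df≡z ⟩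
  ℤtoℚ e ℚ.* ℤtoℚ z               ≡⟨ ℤtoℚ-* e z ⟨
  ℤtoℚ (e ℤ.* z)                  ∎)
  where open ≡.≡-Reasoning

clears-*ʳ : ∀ d e {f} → Clears d f → Clears (d ℤ.* e) f
clears-*ʳ d e {f} clears = ≡.subst (λ x → Clears x f) (ℤ.*-comm e d) (clears-* d e clears)

i*j≢0 : ∀ {i j} → i ≢ ℤ.0ℤ → j ≢ ℤ.0ℤ → i ℤ.* j ≢ ℤ.0ℤ
i*j≢0 {i} i≢0 j≢0 = Sum.[ i≢0 , j≢0 ]′ ∘ ℤ.i*j≡0⇒i≡0∨j≡0 i

p*q≡0⇒q≡0 : ∀ p {q} → p ≢ 0ℚ → p ℚ.* q ≡ 0ℚ → q ≡ 0ℚ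
p*q≡0⇒q≡0 p {q} p≢0 pq≡0 = begin
  q                     ≡⟨ ℚ.*-identityˡ q ⟨
  1ℚ ℚ.* q              ≡⟨ ≡.cong (ℚ._* q) (ℚ.*-inverseˡ p) ⟨
  ℚ.1/ p ℚ.* p ℚ.* q    ≡⟨ ℚ.*-assoc (ℚ.1/ p) p q ⟩
  ℚ.1/ p ℚ.* (p ℚ.* q)  ≡⟨ ≡.cong (ℚ.1/ p ℚ.*_) pq≡0 ⟩
  ℚ.1/ p ℚ.* 0ℚ         ≡⟨ ℚ.*-zeroʳ (ℚ.1/ p) ⟩
  0ℚ                    ∎
  where
  open ≡.≡-Reasoning
  instance _ = ℚ.≢-nonZero p≢0

clear-poly : ∀ P → ∃ λ d → d ≢ ℤ.0ℤ × Clears d (polyToSeries P)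
clear-poly []       = ℤ.1ℤ , (λ ()) , λ n → ℤ.0ℤ , refl
clear-poly (q ∷ P) with clear-poly P
... | d , d≢0 , clears = ↧ q ℤ.* d , i*j≢0 {↧ q} (λ ()) d≢0 , λ where
  zero    → clears-*ʳ (↧ q) d {λ _ → q} (λ _ → ↥ q , ↧*-≡-↥ q) 0
  (suc n) → clears-* d (↧ q) clears n

clear-polys : ∀ {N} (P : Fin N → Polyℚ) → ∃ λ d → d ≢ ℤ.0ℤ × ∀ k → Clears d (polyToSeries (P k))
clear-polys {zero}  P = ℤ.1ℤ , (λ ()) , λ ()
clear-polys {suc N} P with clear-poly (P zero) | clear-polys (P ∘ suc)
... | d , d≢0 , clears-head | e , e≢0 , clears-tail = d ℤ.* e , i*j≢0 d≢0 e≢0 , λ where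
  zero    → clears-*ʳ d e clears-head
  (suc k) → clears-* e d (clears-tail k)

polyToSeries-length : ∀ P n → List.length P ≤ n → polyToSeries P n ≡ 0ℚ
polyToSeries-length []      n       _   = refl
polyToSeries-length (c ∷ P) (suc n) P≤n = polyToSeries-length P n (s≤s⁻¹ P≤n)

nonzero-coefficient : ∀ {P} → NonzeroPoly P → ∃ λ n → polyToSeries P n ≢ 0ℚ
nonzero-coefficient (here q≢0) = 0 , q≢0
nonzero-coefficient (there P≢0) with nonzero-coefficient P≢0
... | n , Pₙ≢0 = suc n , Pₙ≢0

toPoly : ∀ {d} → Vec ℤ d → Polyℚ
toPoly b = Vec.toList (Vec.map ℤtoℚ b)

toPoly-toSeries : ∀ {d} (b : Vec ℤ d) → polyToSeries (toPoly b) ≈ₛ toSeries (vecToSeries b)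
toPoly-toSeries []       n       = refl
toPoly-toSeries (x ∷ b)  zero    = refl
toPoly-toSeries (x ∷ b)  (suc n) = toPoly-toSeries b n

toPoly-nonzero : ∀ {d} {b : Vec ℤ d} → VecAny.Any (_≢ ℤ.0ℤ) b → NonzeroPoly (toPoly b)
toPoly-nonzero (here x≢0)  = here (x≢0 ∘ ℤtoℚ-injective)
toPoly-nonzero (there b≢0) = there (toPoly-nonzero b≢0)

-- The numerator is b·ψ cut off at `d`, from where on it vanishes.
rational-toSeries : ∀ {d ψ h} (b : Vec ℤ d) → VecAny.Any (_≢ ℤ.0ℤ) b →
  (∀ n → ℤ-Series.mul (vecToSeries b) ψ (d ℕ.+ n) ≡ ℤ.0ℤ) → h ≈ₛ toSeries ψ → IsRational h
rational-toSeries {d} {ψ} {h} b b≢0 vanishes h≈ψ =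
  toPoly (prefix d bψ) , toPoly b , toPoly-nonzero b≢0 , λ n → begin
    (polyToSeries (toPoly b) *ₛ h) n                      ≡⟨ *ₛ-mul (polyToSeries (toPoly b)) h n ⟩
    ℚ-Series.mul (polyToSeries (toPoly b)) h n            ≡⟨ ℚ-Series.S.*-cong (toPoly-toSeries b) h≈ψ n ⟩
    ℚ-Series.mul (toSeries (vecToSeries b)) (toSeries ψ) n ≡⟨ mul-toSeries (vecToSeries b) ψ n ⟩
    ℤtoℚ (bψ n)                                           ≡⟨ ≡.cong ℤtoℚ (prefix-complete {_~_ = _≡_} refl d bψ bψ-length n) ⟩
    ℤtoℚ (vecToSeries (prefix d bψ) n)                    ≡⟨ toPoly-toSeries (prefix d bψ) n ⟨
    polyToSeries (toPoly (prefix d bψ)) n                 ∎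
  where
  open ≡.≡-Reasoning

  bψ : ℕ → ℤ
  bψ = ℤ-Series.mul (vecToSeries b) ψ

  bψ-length : ∀ n → d ≤ n → bψ n ≡ ℤ.0ℤ
  bψ-length n d≤n = ≡.subst (λ m → bψ m ≡ ℤ.0ℤ) (ℕ.m+[n∸m]≡n d≤n) (vanishes (n ℕ.∸ d))

sumFinₛ-sum : ∀ {s} (h : Fin s → Series) → sumFinₛ s h ≈ₛ ℚ-Series.sum h
sumFinₛ-sum {zero}  h n = refl
sumFinₛ-sum {suc s} h n = ≡.cong (h zero n ℚ.+_) (sumFinₛ-sum (h ∘ suc) n)

theorem10p1 : (s : ℕ) (a : Fin s → ℕ → ℤ) →
    (∀ i → Inℒ (a i)) →
    (∀ (c : Fin s → ℚ) → (∃ λ i → c i ≢ 0ℚ) →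
    ¬ IsRational (sumFinₛ s (λ i → c i ·ₛ logDeriv (toSeries (a i))))) →
    AlgIndependent s (λ i → toSeries (a i))
theorem10p1 s a inℒ logDeriv-independent P P≢0 P[a]≈0 =
  monomials-independent a (inverse ∘ a) (λ i → mul-inverseʳ (a i) (proj₁ (inℒ i)))
    (λ i → proj₁ (proj₂ (inℒ i))) irrational v (lookup-distinct (terms-distinct s P))
    c L c-length relation (k₀ , n₀ , c≢0)
  where
  open ≡.≡-Reasoning

  N : ℕ
  N = List.length (terms s P)

  v : Fin N → Vec ℕ s
  v k = proj₁ (List.lookup (terms s P) k)

  coefficient : Fin N → Polyℚ
  coefficient k = proj₂ (List.lookup (terms s P) k)

  -- One denominator for all terms, so that the relation is scaled as a whole.
  d : ℤ
  d = proj₁ (clear-polys coefficient)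

  d≢0 : d ≢ ℤ.0ℤ
  d≢0 = proj₁ (proj₂ (clear-polys coefficient))

  c : Fin N → ℕ → ℤ
  c k n = proj₁ (proj₂ (proj₂ (clear-polys coefficient)) k n)

  c-coefficient : ∀ k n → ℤtoℚ d ℚ.* polyToSeries (coefficient k) n ≡ ℤtoℚ (c k n)
  c-coefficient k n = proj₂ (proj₂ (proj₂ (clear-polys coefficient)) k n)

  L : ℕ
  L = proj₁ (upper-bound (List.length ∘ coefficient))

  c-length : ∀ k n → L ≤ n → c k n ≡ ℤ.0ℤ
  c-length k n L≤n = ℤtoℚ-injective (begin
    ℤtoℚ (c k n)                                   ≡⟨ c-coefficient k n ⟨
    ℤtoℚ d ℚ.* polyToSeries (coefficient k) n      ≡⟨ ≡.cong (ℤtoℚ d ℚ.*_) (polyToSeries-length (coefficient k) n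
                                                        (ℕ.≤-trans (proj₂ (upper-bound (List.length ∘ coefficient)) k) L≤n)) ⟩
    ℤtoℚ d ℚ.* 0ℚ                                  ≡⟨ ℚ.*-zeroʳ (ℤtoℚ d) ⟩
    0ℚ                                             ∎)

  nonzero-term : Any (NonzeroPoly ∘ proj₂) (terms s P)
  nonzero-term = terms-nonzero s P P≢0

  k₀ : Fin N
  k₀ = Any.index nonzero-term

  n₀ : ℕ
  n₀ = proj₁ (nonzero-coefficient (Any.lookup-index nonzero-term))

  c≢0 : c k₀ n₀ ≢ ℤ.0ℤ
  c≢0 c≡0 = proj₂ (nonzero-coefficient (Any.lookup-index nonzero-term))
    (p*q≡0⇒q≡0 (ℤtoℚ d) (d≢0 ∘ ℤtoℚ-injective) (≡.trans (c-coefficient k₀ n₀) (≡.cong ℤtoℚ c≡0)))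

  relation : ∀ n → ℤ-Series.sum (λ k → ℤ-Series.mul (c k) (ℤ-Series.monomial a (v k))) n ≡ ℤ.0ℤ
  relation n = ℤtoℚ-injective (begin
    ℤtoℚ (ℤ-Series.sum (λ k → ℤ-Series.mul (c k) (ℤ-Series.monomial a (v k))) n)
      ≡⟨ sum-toSeries (λ k → ℤ-Series.mul (c k) (ℤ-Series.monomial a (v k))) n ⟨
    sum (λ k → toSeries (ℤ-Series.mul (c k) (ℤ-Series.monomial a (v k)))) n
      ≡⟨ sum-cong scaled-term n ⟩
    sum (λ k i → ℤtoℚ d ℚ.* mul (polyToSeries (coefficient k)) (monomial (toSeries ∘ a) (v k)) i) n
      ≡⟨ sum-scale (ℤtoℚ d) (λ k → mul (polyToSeries (coefficient k)) (monomial (toSeries ∘ a) (v k))) n ⟩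
    ℤtoℚ d ℚ.* evalTerms (terms s P) (toSeries ∘ a) n
      ≡⟨ ≡.cong (ℤtoℚ d ℚ.*_) (evalMPoly-terms s P (toSeries ∘ a) n) ⟨
    ℤtoℚ d ℚ.* evalMPoly s P (toSeries ∘ a) n
      ≡⟨ ≡.cong (ℤtoℚ d ℚ.*_) (P[a]≈0 n) ⟩
    ℤtoℚ d ℚ.* 0ℚ
      ≡⟨ ℚ.*-zeroʳ (ℤtoℚ d) ⟩
    0ℚ ∎)
    where
    open ℚ-Series

    scaled-term : ∀ k i → ℤtoℚ (ℤ-Series.mul (c k) (ℤ-Series.monomial a (v k)) i) ≡
      ℤtoℚ d ℚ.* mul (polyToSeries (coefficient k)) (monomial (toSeries ∘ a) (v k)) i
    scaled-term k i = begin
      ℤtoℚ (ℤ-Series.mul (c k) (ℤ-Series.monomial a (v k)) i)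
        ≡⟨ mul-toSeries (c k) (ℤ-Series.monomial a (v k)) i ⟨
      mul (toSeries (c k)) (toSeries (ℤ-Series.monomial a (v k))) i
        ≡⟨ S.*-cong (c-coefficient k) (monomial-toSeries a (v k)) i ⟨
      mul (λ n → ℤtoℚ d ℚ.* polyToSeries (coefficient k) n) (monomial (toSeries ∘ a) (v k)) i
        ≡⟨ mul-scaleˡ (ℤtoℚ d) (polyToSeries (coefficient k)) (monomial (toSeries ∘ a) (v k)) i ⟩
      ℤtoℚ d ℚ.* mul (polyToSeries (coefficient k)) (monomial (toSeries ∘ a) (v k)) i ∎

    sum-scale : ∀ {N} q (h : Fin N → Series) n → sum (λ k i → q ℚ.* h k i) n ≡ q ℚ.* sum h n
    sum-scale {zero}  q h n = ≡.sym (ℚ.*-zeroʳ q)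
    sum-scale {suc N} q h n = ≡.trans (≡.cong (q ℚ.* h zero n ℚ.+_) (sum-scale q (h ∘ suc) n))
      (≡.sym (ℚ.*-distribˡ-+ q (h zero n) (sum (h ∘ suc) n)))

  irrational : ∀ (m : Fin s → ℤ) → (∃ λ i → m i ≢ ℤ.0ℤ) → ∀ d →
    Irrational d (ℤ-Series.sum λ i n → m i ℤ.* ℤ-Series.mul (ℤ-Series.∂ (a i)) (inverse (a i)) n)
  irrational m (i , mᵢ≢0) d b b≢0 vanishes = logDeriv-independent (ℤtoℚ ∘ m)
    (i , mᵢ≢0 ∘ ℤtoℚ-injective) (rational-toSeries b b≢0 vanishes λ n → begin
      sumFinₛ s (λ i → ℤtoℚ (m i) ·ₛ logDeriv (toSeries (a i))) n
        ≡⟨ sumFinₛ-sum (λ i → ℤtoℚ (m i) ·ₛ logDeriv (toSeries (a i))) n ⟩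
      ℚ-Series.sum (λ i → ℤtoℚ (m i) ·ₛ logDeriv (toSeries (a i))) n
        ≡⟨ ℚ-Series.sum-cong (λ i n → ≡.trans (≡.cong (ℤtoℚ (m i) ℚ.*_) (logDeriv-toSeries (a i) n))
             (≡.sym (ℤtoℚ-* (m i) (ℤ-Series.mul (ℤ-Series.∂ (a i)) (inverse (a i)) n)))) n ⟩
      ℚ-Series.sum (λ i → toSeries λ n → m i ℤ.* ℤ-Series.mul (ℤ-Series.∂ (a i)) (inverse (a i)) n) n
        ≡⟨ sum-toSeries (λ i n → m i ℤ.* ℤ-Series.mul (ℤ-Series.∂ (a i)) (inverse (a i)) n) n ⟩
      ℤtoℚ (ℤ-Series.sum (λ i n → m i ℤ.* ℤ-Series.mul (ℤ-Series.∂ (a i)) (inverse (a i)) n) n) ∎)
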